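{- (1) For every first-order sentence $\phi$ (in $\in$): $\mathsf{LT}_1^+\vdash\phi$ iff $\mathsf{LT}_b^+\vdash\phi$. (2) For every second-order sentence $\phi$: $\mathsf{LT}_b^+\vdash\phi$ iff $\mathsf{LT}_1^+\vdash\phi^{\downarrow}$. Moreover, $\mathsf{LT}_b^+$ proves that the translation $\downarrow$ is the identity on first-order entities and an isomorphism on second-order entities (an $n$-ary second-order entity $F$ corresponding to the set $\{\langle x_1,\dots,x_n\rangle:F(x_1,\dots,x_n)\}$).
   Context: $\mathrm{pot}(a)=\{x:\exists c(x\subseteq c\in a)\}$; a history is an $h$ with $x=\mathrm{pot}(x\cap h)$ for all $x\in h$; $\mathrm{Lev}(s)$ iff $s=\mathrm{pot}(h)$ for a history $h$. Endless: $\forall s(\mathrm{Lev}(s)\to\exists t(\mathrm{Lev}(t)\land s\in t))$. $\mathsf{LT}_1^+$: first-order theory in $\in$ with Extensionality, the Separation scheme, Stratification ($\forall a\exists s(\mathrm{Lev}(s)\land a\subseteq s)$) and Endless. $\mathsf{LT}_b^+$ (bounded Level Theory plus Endless): second-order logic with $n$-ary second-order variables, axioms Extensionality, Separation (second-order axiom), Stratification, Endless, Strat$_b$: $\forall F\exists s(\mathrm{Lev}(s)\land F\sqsubseteq s)$, and the scheme Comp$_b$: $\forall s(\mathrm{Lev}(s)\to\exists F(F\sqsubseteq s\land\forall\vec x((x_1\subseteq s\land\dots\land x_n\subseteq s)\to(F(\vec x)\leftrightarrow\phi))))$ for $\phi$ not containing $F$, which replaces the usual Comprehension scheme; here $F\sqsubseteq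 s$ abbreviates $\forall\vec x(F(\vec x)\to(x_1\subseteq s\land\dots\land x_n\subseteq s))$. Second-order identity is coextensionality. The translation $\downarrow$ treats each $n$-ary second-order variable $Y^n$ as a new first-order variable, with $(Y^n(x_1,\dots,x_n))^\downarrow=\langle x_1,\dots,x_n\rangle\in Y^n$ (Wiener–Kuratowski tuples) and $(\forall Y^n\phi)^\downarrow=\forall Y^n((\forall z\in Y^n)(z\text{ is an }n\text{ -tuple})\to\phi^\downarrow)$, and commutes with all other connectives and first-order quantifiers. -}

module Defs where

open import Data.Bool using (Bool; true; false; if_then_else_)
open import Data.Nat using (ℕ; zero; suc; _+_; _<_; _≡ᵇ_)
open import Data.Vec using (Vec; []; _∷_; map)
open import Data.Vec.Relation.Unary.All using (All)
open import Data.Product using (_×_)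
open import Data.Unit using (⊤)
open import Function using (_∘_; id)

-- Syntax.  Formula false = first-order formulas in the language {∈, =};
-- Formula true = second-order formulas (additionally n-ary second-order
-- variables, n ≥ 1, and quantifiers over them).
-- Variables are de Bruijn indices.  First-order variables form one index
-- space; second-order variables of arity (k+1) form their own index space
-- (one for each k).  app k i xs : the i-th second-order variable of arity
-- k+1 applied to xs.  all2 k φ binds index 0 of arity k+1.

data Formula : Bool → Set where
  mem  : ∀ {b} → ℕ → ℕ → Formula b
  eq   : ∀ {b} → ℕ → ℕ → Formula b
  bot  : ∀ {b} → Formula b
  imp  : ∀ {b} → Formula b → Formula b → Formula b
  all  : ∀ {b} → Formula b → Formula b
  app  : (k : ℕ) → ℕ → Vec ℕ (suc k) → Formula true
  all2 : (k : ℕ) → Formula true → Formula true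

neg : ∀ {b} → Formula b → Formula b
neg φ = imp φ bot

or : ∀ {b} → Formula b → Formula b → Formula b
or φ ψ = imp (neg φ) ψ

and : ∀ {b} → Formula b → Formula b → Formula b
and φ ψ = neg (imp φ (neg ψ))

iff : ∀ {b} → Formula b → Formula b → Formula b
iff φ ψ = and (imp φ ψ) (imp ψ φ)

ex : ∀ {b} → Formula b → Formula b
ex φ = neg (all (neg φ))

ex2 : ℕ → Formula true → Formula true
ex2 k φ = neg (all2 k (neg φ))

allN : ∀ {b} → ℕ → Formula b → Formula b
allN zero φ = φ
allN (suc n) φ = all (allN n φ)

exN : ∀ {b} → ℕ → Formula b → Formula b
exN zero φ = φ
exN (suc n) φ = ex (exN n φ)

andAll : ∀ {b n} → Vec (Formula b) (suc n) → Formula b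
andAll (φ ∷ []) = φ
andAll (φ ∷ ψ ∷ ψs) = and φ (andAll (ψ ∷ ψs))

-- bvars k = [k, k-1, ..., 0]: the variables bound by k+1 consecutive
-- quantifiers, outermost first.
bvars : (k : ℕ) → Vec ℕ (suc k)
bvars zero = 0 ∷ []
bvars (suc k) = suc k ∷ bvars k

-- Renaming (the only substitution needed: terms are variables)

ext : (ℕ → ℕ) → ℕ → ℕ
ext ρ zero = zero
ext ρ (suc i) = suc (ρ i)

ext2 : ℕ → (ℕ → ℕ → ℕ) → ℕ → ℕ → ℕ
ext2 k σ j = if j ≡ᵇ k then ext (σ j) else σ j

ren : ∀ {b} → (ℕ → ℕ) → (ℕ → ℕ → ℕ) → Formula b → Formula b
ren ρ σ (mem x y) = mem (ρ x) (ρ y)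
ren ρ σ (eq x y) = eq (ρ x) (ρ y)
ren ρ σ bot = bot
ren ρ σ (imp φ ψ) = imp (ren ρ σ φ) (ren ρ σ ψ)
ren ρ σ (all φ) = all (ren (ext ρ) σ φ)
ren ρ σ (app k i xs) = app k (σ k i) (map ρ xs)
ren ρ σ (all2 k φ) = all2 k (ren ρ (ext2 k σ) φ)

id2 : ℕ → ℕ → ℕ
id2 _ i = i

wk : ∀ {b} → Formula b → Formula b
wk = ren suc id2

shift2 : ℕ → ℕ → ℕ → ℕ
shift2 k j = if j ≡ᵇ k then suc else id

wk2 : ℕ → Formula true → Formula true
wk2 k = ren id (shift2 k)

inst : ℕ → ℕ → ℕ
inst x zero = x
inst x (suc i) = i

inst2 : ℕ → ℕ → ℕ → ℕ → ℕ
inst2 k Y j = if j ≡ᵇ k then inst Y else id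

bump : ℕ → (ℕ → ℕ) → ℕ → ℕ
bump k c j = if j ≡ᵇ k then suc (c j) else c j

Scoped : ∀ {b} → ℕ → (ℕ → ℕ) → Formula b → Set
Scoped m c (mem x y) = (x < m) × (y < m)
Scoped m c (eq x y) = (x < m) × (y < m)
Scoped m c bot = ⊤
Scoped m c (imp φ ψ) = Scoped m c φ × Scoped m c ψ
Scoped m c (all φ) = Scoped (suc m) c φ
Scoped m c (app k i xs) = (i < c k) × All (_< m) xs
Scoped m c (all2 k φ) = Scoped m (bump k c) φ

Sentence : ∀ {b} → Formula b → Set
Sentence = Scoped 0 (λ _ → 0)

subset : ∀ {b} → ℕ → ℕ → Formula b
subset x y = all (imp (mem 0 (suc x)) (mem 0 (suc y)))

PotEq : ∀ {b} → ℕ → ℕ → Formula b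
PotEq s h = all (iff (mem 0 (suc s)) (ex (and (mem 0 (suc (suc h))) (subset 1 0))))

-- h is a history: ∀x ∈ h, x = pot(x ∩ h)
Hist : ∀ {b} → ℕ → Formula b
Hist h = all (imp (mem 0 (suc h))
           (all (iff (mem 0 1)
             (ex (and (mem 0 2) (and (mem 0 (suc (suc (suc h)))) (subset 1 0)))))))

Lev : ∀ {b} → ℕ → Formula b
Lev s = ex (and (Hist 0) (PotEq (suc s) 0))

Sing : ∀ {b} → ℕ → ℕ → Formula b
Sing w a = all (iff (mem 0 (suc w)) (eq 0 (suc a)))

Doub : ∀ {b} → ℕ → ℕ → ℕ → Formula b
Doub w a c = all (iff (mem 0 (suc w)) (or (eq 0 (suc a)) (eq 0 (suc c))))

IsPair : ∀ {b} → ℕ → ℕ → ℕ → Formula b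
IsPair z a c = all (iff (mem 0 (suc z)) (or (Sing 0 (suc a)) (Doub 0 (suc a) (suc c))))

IsTup : ∀ {b k} → ℕ → Vec ℕ (suc k) → Formula b
IsTup {k = zero} z (x ∷ []) = eq z x
IsTup {k = suc k} z (x ∷ xs) = ex (and (IsTup 0 (map suc xs)) (IsPair (suc z) (suc x) 0))

IsTupleN : ∀ {b} → ℕ → ℕ → Formula b
IsTupleN k z = exN (suc k) (IsTup (z + suc k) (bvars k))

TupMem : ∀ {b k} → Vec ℕ (suc k) → ℕ → Formula b
TupMem xs a = ex (and (IsTup 0 (map suc xs)) (mem 0 (suc a)))

emb : Formula false → Formula true
emb (mem x y) = mem x y
emb (eq x y) = eq x y
emb bot = bot
emb (imp φ ψ) = imp (emb φ) (emb ψ)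
emb (all φ) = all (emb φ)

-- ρ: first-order variables ↦ first-order variables;
-- σ k i: i-th second-order variable of arity k+1 ↦ first-order variable
extT : ℕ → (ℕ → ℕ → ℕ) → ℕ → ℕ → ℕ
extT k σ j = if j ≡ᵇ k then ext (σ j) else suc ∘ σ j

tr : (ℕ → ℕ) → (ℕ → ℕ → ℕ) → Formula true → Formula false
tr ρ σ (mem x y) = mem (ρ x) (ρ y)
tr ρ σ (eq x y) = eq (ρ x) (ρ y)
tr ρ σ bot = bot
tr ρ σ (imp φ ψ) = imp (tr ρ σ φ) (tr ρ σ ψ)
tr ρ σ (all φ) = all (tr (ext ρ) (λ k → suc ∘ σ k) φ)
tr ρ σ (app k i xs) = TupMem (map ρ xs) (σ k i)
tr ρ σ (all2 k φ) =
  all (imp (all (imp (mem 0 1) (IsTupleN k 0))) (tr (suc ∘ ρ) (extT k σ) φ))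

_↓ : Formula true → Formula false
φ ↓ = tr id id2 φ

-- Deductive systems (Hilbert style; open formulas read as universally
-- closed).  Second-order quantifier instantiation is by variables only:
-- comprehension is supplied solely by the axioms of the theory (Comp_b).

data LogAx : ∀ {b} → Formula b → Set where
  A1 : ∀ {b} {φ ψ : Formula b} → LogAx (imp φ (imp ψ φ))
  A2 : ∀ {b} {φ ψ χ : Formula b} →
       LogAx (imp (imp φ (imp ψ χ)) (imp (imp φ ψ) (imp φ χ)))
  A3 : ∀ {b} {φ : Formula b} → LogAx (imp (neg (neg φ)) φ)
  Q1 : ∀ {b} {φ : Formula b} (x : ℕ) → LogAx (imp (all φ) (ren (inst x) id2 φ))
  Q2 : ∀ {b} {φ ψ : Formula b} → LogAx (imp (all (imp (wk ψ) φ)) (imp ψ (all φ)))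
  E1 : ∀ {b} (x : ℕ) → LogAx {b} (eq x x)
  E2 : ∀ {b} {φ : Formula b} (x y : ℕ) →
       LogAx (imp (eq x y) (imp (ren (inst x) id2 φ) (ren (inst y) id2 φ)))
  S1 : ∀ {φ : Formula true} (k Y : ℕ) → LogAx (imp (all2 k φ) (ren id (inst2 k Y) φ))
  S2 : ∀ {φ ψ : Formula true} (k : ℕ) →
       LogAx (imp (all2 k (imp (wk2 k ψ) φ)) (imp ψ (all2 k φ)))

infix 4 _⊢_
data _⊢_ : ∀ {b} → (Formula b → Set) → Formula b → Set₁ where
  ax   : ∀ {b} {T : Formula b → Set} {φ} → T φ → T ⊢ φ
  lax  : ∀ {b} {T : Formula b → Set} {φ} → LogAx φ → T ⊢ φ
  mp   : ∀ {b} {T : Formula b → Set} {φ ψ} → T ⊢ imp φ ψ → T ⊢ φ → T ⊢ ψ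
  gen  : ∀ {b} {T : Formula b → Set} {φ} → T ⊢ φ → T ⊢ all φ
  gen2 : ∀ {T : Formula true → Set} {φ} (k : ℕ) → T ⊢ φ → T ⊢ all2 k φ

Extensionality : ∀ {b} → Formula b
Extensionality = all (all (imp (all (iff (mem 0 2) (mem 0 1))) (eq 1 0)))

Stratification : ∀ {b} → Formula b
Stratification = all (ex (and (Lev 0) (all (imp (mem 0 2) (mem 0 1)))))

Endless : ∀ {b} → Formula b
Endless = all (imp (Lev 0) (ex (and (Lev 0) (mem 1 0))))

-- Separation instance for φ (variable 0 of φ is the separated x;
-- variable i+1 of φ is a parameter):  ∀a ∃b ∀x (x ∈ b ↔ x ∈ a ∧ φ)
sepρ : ℕ → ℕ
sepρ zero = zero
sepρ (suc i) = suc (suc (suc i))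

SeparationInst : Formula false → Formula false
SeparationInst φ = all (ex (all (iff (mem 0 1) (and (mem 0 2) (ren sepρ id2 φ)))))

Separation2 : Formula true
Separation2 = all2 0 (all (ex (all (iff (mem 0 1) (and (mem 0 2) (app 0 0 (0 ∷ [])))))))

Sq : ℕ → ℕ → ℕ → Formula true
Sq k F s = allN (suc k) (imp (app k F (bvars k))
                          (andAll (map (λ x → subset x (s + suc k)) (bvars k))))

StratB : ℕ → Formula true
StratB k = all2 k (ex (and (Lev 0) (Sq k 0 0)))

-- Comp_b instance: ∀s (Lev(s) → ∃F (F ⊑ s ∧ ∀x⃗ (x⃗ ⊆ s → (F(x⃗) ↔ φ))))
-- φ is read in the scope of ∀s ∃F ∀x₁…∀x_{k+1}; it cannot mention F
-- (its arity-(k+1) second-order variables are shifted past F).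
CompB : ℕ → Formula true → Formula true
CompB k φ = all (imp (Lev 0) (ex2 k (and (Sq k 0 0)
              (allN (suc k) (imp (andAll (map (λ x → subset x (suc k)) (bvars k)))
                                 (iff (app k 0 (bvars k)) (wk2 k φ)))))))

data LT1+ : Formula false → Set where
  extAx   : LT1+ Extensionality
  sep     : (φ : Formula false) → LT1+ (SeparationInst φ)
  strat   : LT1+ Stratification
  endless : LT1+ Endless

data LTb+ : Formula true → Set where
  extAx   : LTb+ Extensionality
  sep     : LTb+ Separation2
  strat   : LTb+ Stratification
  endless : LTb+ Endless
  stratb  : (k : ℕ) → LTb+ (StratB k)
  compb   : (k : ℕ) (φ : Formula true) → LTb+ (CompB k φ)

Corr : ℕ → ℕ → ℕ → Formula true
Corr k F a = allN (suc k) (iff (app k F (bvars k)) (TupMem (bvars k) (a + suc k)))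

TupSet : ∀ {b} → ℕ → ℕ → Formula b
TupSet k a = all (imp (mem 0 (suc a)) (IsTupleN k 0))

Iso1 : ℕ → Formula true
Iso1 k = all2 k (ex (and (TupSet k 0) (Corr k 0 0)))

Iso2 : ℕ → Formula true
Iso2 k = all (imp (TupSet k 0) (ex2 k (Corr k 0 0)))

{-# OPTIONS --safe #-}

-- The proof is model-theoretic.  Both calculi are complete for Tarskian structures in which falsity
-- is read as an arbitrary type R and every atom is stable under double negation relative to R;
-- with this reading Henkin's construction is constructive (Krivine).
--
-- In a model of LT1+ the levels are well-ordered by ∈: Russell's paradox gives
-- foundation for classes of potent sets, and foundation gives comparability.  With Endless this yields
-- pairs, so Kuratowski tuples exist and are injective.  Letting the second-order variables of
-- arity n range over the sets of n-tuples expands every model of LT1+ to a model of LTb+, in which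
-- φ holds iff φ ↓ holds in the original model.  Conversely the first-order part of a model of LTb+ satisfies
-- LT1+, since Comp_b below a level containing a gives every instance of Separation on a, and the
-- model is isomorphic to the tuple expansion of this first-order part by Strat_b and Comp_b.

module Submission where

open import Defs
open import Data.Bool using (Bool; true; false; if_then_else_) renaming (T to Is-true)
open import Data.Empty using (⊥-elim)
open import Data.List as List using (List; []; _∷_; _++_)
open import Data.List.Membership.Propositional using () renaming (_∈_ to _∈ˡ_)
open import Data.List.Membership.Propositional.Properties using (∈-++⁺ˡ; ∈-++⁺ʳ)
open import Data.List.Relation.Unary.All as All using (All; []; _∷_)
open import Data.List.Relation.Unary.All.Properties using (++⁺)
open import Data.List.Relation.Unary.Any using (here; there)
open import Data.Nat using (ℕ; zero; suc; _+_; _⊔_; _≤_; _<_; s≤s; _≡ᵇ_; _≤′_; ≤′-refl; ≤′-step)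
open import Data.Nat.Properties using (≤-refl; ≤-trans; <-irrefl; ≤⇒≤′; m≤m⊔n; m≤n⊔m; n≤1+n; +-suc; +-comm; +-identityʳ; suc-injective; ≡ᵇ⇒≡; _≟_)
open import Data.Product using (Σ; _×_; _,_; proj₁; proj₂)
open import Data.Sum using (_⊎_; inj₁; inj₂)
open import Data.Unit using (tt)
open import Data.Unit.Polymorphic using (⊤)
open import Data.Vec as Vec using (Vec; []; _∷_)
open import Data.Vec.Properties using (map-∘; map-cong; map-id)
open import Data.Vec.Relation.Binary.Pointwise.Inductive as PW using (Pointwise; []; _∷_)
open import Data.Vec.Relation.Unary.All as VAll using ([]; _∷_)
open import Function using (_∘_; id)
open import Level using (Lift; lift)
open import Relation.Binary.PropositionalEquality using (_≡_; refl; sym; trans; cong; cong₂; subst)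
open import Relation.Nullary using (yes; no)

-- Renaming

-- Converting derivations directly would require Hilbert proofs, inside `LT1+`, that levels are
-- comparable and tuples injective. In an arbitrary structure these become ordinary Agda arguments.
-- The price is double negation: `Ex P` releases its witness only while the goal is `R` or stable,
-- so the proofs run in continuation style and often open with a stability lemma. The freedom in `R`
-- is forced by the Lindenbaum step. Consistency cannot be decided, so the term model is built from
-- the negated goal without knowing it consistent; there `R` is `True bot`, and a validity proof
-- read in that model returns a refutation of the negated goal. Sets of tuples are only part of the
-- domain, hence the guard `Ok` on second-order quantifiers. Free second-order variables must
-- satisfy it too, which calls for a default value that is admissible at every arity.

ext-∘ : ∀ {ρ ρ′ ρ″} → (∀ x → ρ (ρ′ x) ≡ ρ″ x) → ∀ x → ext ρ (ext ρ′ x) ≡ ext ρ″ x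
ext-∘ h zero = refl
ext-∘ h (suc x) = cong suc (h x)

ext2-∘ : ∀ k {σ σ′ σ″} → (∀ j i → σ j (σ′ j i) ≡ σ″ j i) →
         ∀ j i → ext2 k σ j (ext2 k σ′ j i) ≡ ext2 k σ″ j i
ext2-∘ k h j i with j ≡ᵇ k
... | true = ext-∘ (h j) i
... | false = h j i

ren-∘ : ∀ {b} (φ : Formula b) {ρ ρ′ ρ″ σ σ′ σ″} →
        (∀ x → ρ (ρ′ x) ≡ ρ″ x) → (∀ j i → σ j (σ′ j i) ≡ σ″ j i) →
        ren ρ σ (ren ρ′ σ′ φ) ≡ ren ρ″ σ″ φ
ren-∘ (mem x y) h h₂ = cong₂ mem (h x) (h y)
ren-∘ (eq x y) h h₂ = cong₂ eq (h x) (h y)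
ren-∘ bot h h₂ = refl
ren-∘ (imp φ ψ) h h₂ = cong₂ imp (ren-∘ φ h h₂) (ren-∘ ψ h h₂)
ren-∘ (all φ) h h₂ = cong all (ren-∘ φ (ext-∘ h) h₂)
ren-∘ (app k i xs) h h₂ =
  cong₂ (app k) (h₂ k i) (trans (sym (map-∘ _ _ xs)) (map-cong h xs))
ren-∘ (all2 k φ) h h₂ = cong (all2 k) (ren-∘ φ h (ext2-∘ k h₂))

ext-id : ∀ {ρ} → (∀ x → ρ x ≡ x) → ∀ x → ext ρ x ≡ x
ext-id h zero = refl
ext-id h (suc x) = cong suc (h x)

ext2-id : ∀ k {σ} → (∀ j i → σ j i ≡ i) → ∀ j i → ext2 k σ j i ≡ i
ext2-id k h j i with j ≡ᵇ k
... | true = ext-id (h j) i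
... | false = h j i

ren-id : ∀ {b} (φ : Formula b) {ρ σ} → (∀ x → ρ x ≡ x) → (∀ j i → σ j i ≡ i) → ren ρ σ φ ≡ φ
ren-id (mem x y) h h₂ = cong₂ mem (h x) (h y)
ren-id (eq x y) h h₂ = cong₂ eq (h x) (h y)
ren-id bot h h₂ = refl
ren-id (imp φ ψ) h h₂ = cong₂ imp (ren-id φ h h₂) (ren-id ψ h h₂)
ren-id (all φ) h h₂ = cong all (ren-id φ (ext-id h) h₂)
ren-id (app k i xs) h h₂ = cong₂ (app k) (h₂ k i) (trans (map-cong h xs) (map-id xs))
ren-id (all2 k φ) h h₂ = cong (all2 k) (ren-id φ h (ext2-id k h₂))

ext-< : ∀ {m ρ ρ′} → (∀ x → x < m → ρ x ≡ ρ′ x) → ∀ x → x < suc m → ext ρ x ≡ ext ρ′ x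
ext-< h zero _ = refl
ext-< h (suc x) (s≤s p) = cong suc (h x p)

ext2-< : ∀ k {c σ σ′} → (∀ j i → i < c j → σ j i ≡ σ′ j i) →
         ∀ j i → i < bump k c j → ext2 k σ j i ≡ ext2 k σ′ j i
ext2-< k h j i p with j ≡ᵇ k
... | true = ext-< (h j) i p
... | false = h j i p

map-scoped : ∀ {A : Set} {m n} {f g : ℕ → A} (xs : Vec ℕ n) → VAll.All (_< m) xs →
             (∀ x → x < m → f x ≡ g x) → Vec.map f xs ≡ Vec.map g xs
map-scoped [] [] h = refl
map-scoped (x ∷ xs) (p ∷ ps) h = cong₂ _∷_ (h x p) (map-scoped xs ps h)

ren-scoped : ∀ {b} (φ : Formula b) {m c ρ ρ′ σ σ′} → Scoped m c φ →
             (∀ x → x < m → ρ x ≡ ρ′ x) → (∀ j i → i < c j → σ j i ≡ σ′ j i) →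
             ren ρ σ φ ≡ ren ρ′ σ′ φ
ren-scoped (mem x y) (p , q) h h₂ = cong₂ mem (h x p) (h y q)
ren-scoped (eq x y) (p , q) h h₂ = cong₂ eq (h x p) (h y q)
ren-scoped bot _ h h₂ = refl
ren-scoped (imp φ ψ) (p , q) h h₂ = cong₂ imp (ren-scoped φ p h h₂) (ren-scoped ψ q h h₂)
ren-scoped (all φ) p h h₂ = cong all (ren-scoped φ p (ext-< h) h₂)
ren-scoped (app k i xs) (p , ps) h h₂ = cong₂ (app k) (h₂ k i p) (map-scoped xs ps h)
ren-scoped (all2 k φ) p h h₂ = cong (all2 k) (ren-scoped φ p h (ext2-< k h₂))

bump-mono : ∀ k {c c′} → (∀ j → c j ≤ c′ j) → ∀ j → bump k c j ≤ bump k c′ j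
bump-mono k h j with j ≡ᵇ k
... | true = s≤s (h j)
... | false = h j

≤-bump : ∀ k c j → c j ≤ bump k c j
≤-bump k c j with j ≡ᵇ k
... | true = n≤1+n (c j)
... | false = ≤-refl

Scoped-mono : ∀ {b} (φ : Formula b) {m m′ c c′} → m ≤ m′ → (∀ j → c j ≤ c′ j) →
              Scoped m c φ → Scoped m′ c′ φ
Scoped-mono (mem x y) h h₂ (p , q) = ≤-trans p h , ≤-trans q h
Scoped-mono (eq x y) h h₂ (p , q) = ≤-trans p h , ≤-trans q h
Scoped-mono bot h h₂ p = tt
Scoped-mono (imp φ ψ) h h₂ (p , q) = Scoped-mono φ h h₂ p , Scoped-mono ψ h h₂ q
Scoped-mono (all φ) h h₂ p = Scoped-mono φ (s≤s h) h₂ p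
Scoped-mono (app k i xs) h h₂ (p , ps) = ≤-trans p (h₂ k) , VAll.map (λ q → ≤-trans q h) ps
Scoped-mono (all2 k φ) h h₂ p = Scoped-mono φ h (bump-mono k h₂) p

vecBound : ∀ {n} → Vec ℕ n → ℕ
vecBound [] = 0
vecBound (x ∷ xs) = suc x ⊔ vecBound xs

vecBound-< : ∀ {n} (xs : Vec ℕ n) → VAll.All (_< vecBound xs) xs
vecBound-< [] = []
vecBound-< (x ∷ xs) = m≤m⊔n (suc x) (vecBound xs) ∷ VAll.map (λ p → ≤-trans p (m≤n⊔m (suc x) _)) (vecBound-< xs)

-- Quantifiers leave the bound unchanged, which overshoots; it only serves to pick a variable fresh
-- for a finite list of formulas.
bound : ∀ {b} → Formula b → ℕ
bound (mem x y) = suc x ⊔ suc y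
bound (eq x y) = suc x ⊔ suc y
bound bot = 0
bound (imp φ ψ) = bound φ ⊔ bound ψ
bound (all φ) = bound φ
bound (app k i xs) = suc i ⊔ vecBound xs
bound (all2 k φ) = bound φ

ScopedBelow : ∀ {b} → ℕ → Formula b → Set
ScopedBelow n = Scoped n (λ _ → n)

ScopedBelow-mono : ∀ {b} (φ : Formula b) {m n} → m ≤ n → ScopedBelow m φ → ScopedBelow n φ
ScopedBelow-mono φ h = Scoped-mono φ h (λ _ → h)

scoped-bound : ∀ {b} (φ : Formula b) → ScopedBelow (bound φ) φ
scoped-bound (mem x y) = m≤m⊔n (suc x) (suc y) , m≤n⊔m (suc x) (suc y)
scoped-bound (eq x y) = m≤m⊔n (suc x) (suc y) , m≤n⊔m (suc x) (suc y)
scoped-bound bot = tt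
scoped-bound (imp φ ψ) =
  ScopedBelow-mono φ (m≤m⊔n _ _) (scoped-bound φ) , ScopedBelow-mono ψ (m≤n⊔m (bound φ) _) (scoped-bound ψ)
scoped-bound (all φ) = Scoped-mono φ (n≤1+n _) (λ _ → ≤-refl) (scoped-bound φ)
scoped-bound (app k i xs) =
  m≤m⊔n (suc i) (vecBound xs) , VAll.map (λ p → ≤-trans p (m≤n⊔m (suc i) _)) (vecBound-< xs)
scoped-bound (all2 k φ) = Scoped-mono φ ≤-refl (≤-bump k _) (scoped-bound φ)

≡ᵇ-refl : ∀ k → (k ≡ᵇ k) ≡ true
≡ᵇ-refl zero = refl
≡ᵇ-refl (suc k) = ≡ᵇ-refl k

≡ᵇ-true : ∀ {j k} → (j ≡ᵇ k) ≡ true → j ≡ k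
≡ᵇ-true {j} {k} e = ≡ᵇ⇒≡ j k (subst Is-true (sym e) tt)

-- Deductions are closed under renaming

-- Generalising over a Henkin variable renames a whole derivation, axioms included. In a scheme,
-- renaming the parameters of one instance gives another.
RenClosed : ∀ {b} → (Formula b → Set) → Set
RenClosed T = ∀ {φ} ρ σ → T φ → T (ren ρ σ φ)

ren-inst : ∀ {b} (φ : Formula b) ρ σ x →
           ren ρ σ (ren (inst x) id2 φ) ≡ ren (inst (ρ x)) id2 (ren (ext ρ) σ φ)
ren-inst φ ρ σ x =
  trans (ren-∘ φ (λ _ → refl) (λ _ _ → refl))
        (sym (ren-∘ φ (λ { zero → refl ; (suc i) → refl }) (λ _ _ → refl)))

ren-wk : ∀ {b} (φ : Formula b) ρ σ → ren (ext ρ) σ (wk φ) ≡ wk (ren ρ σ φ)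
ren-wk φ ρ σ =
  trans (ren-∘ φ (λ _ → refl) (λ _ _ → refl)) (sym (ren-∘ φ (λ _ → refl) (λ _ _ → refl)))

ren-inst2 : ∀ (φ : Formula true) ρ σ k Y →
            ren ρ σ (ren id (inst2 k Y) φ) ≡ ren id (inst2 k (σ k Y)) (ren ρ (ext2 k σ) φ)
ren-inst2 φ ρ σ k Y =
  trans (ren-∘ φ {σ″ = λ j i → σ j (inst2 k Y j i)} (λ _ → refl) (λ _ _ → refl))
        (sym (ren-∘ φ (λ _ → refl) same))
  where
  same : ∀ j i → inst2 k (σ k Y) j (ext2 k σ j i) ≡ σ j (inst2 k Y j i)
  same j i with j ≡ᵇ k in e
  same j i | false = refl
  same j (suc i) | true = refl
  same j zero | true = cong (λ l → σ l Y) (sym (≡ᵇ-true e))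

ren-wk2 : ∀ k φ ρ σ → ren ρ (ext2 k σ) (wk2 k φ) ≡ wk2 k (ren ρ σ φ)
ren-wk2 k φ ρ σ =
  trans (ren-∘ φ (λ _ → refl) same) (sym (ren-∘ φ (λ _ → refl) (λ _ _ → refl)))
  where
  same : ∀ j i → ext2 k σ j (shift2 k j i) ≡ shift2 k j (σ j i)
  same j i with j ≡ᵇ k
  ... | true = refl
  ... | false = refl

LogAx-ren : ∀ {b} {φ : Formula b} ρ σ → LogAx φ → LogAx (ren ρ σ φ)
LogAx-ren ρ σ A1 = A1
LogAx-ren ρ σ A2 = A2
LogAx-ren ρ σ A3 = A3
LogAx-ren ρ σ (Q1 {φ = φ} x) rewrite ren-inst φ ρ σ x = Q1 (ρ x)
LogAx-ren ρ σ (Q2 {ψ = ψ}) rewrite ren-wk ψ ρ σ = Q2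
LogAx-ren ρ σ (E1 x) = E1 (ρ x)
LogAx-ren ρ σ (E2 {φ = φ} x y) rewrite ren-inst φ ρ σ x | ren-inst φ ρ σ y =
  E2 {φ = ren (ext ρ) σ φ} (ρ x) (ρ y)
LogAx-ren ρ σ (S1 {φ} k Y) =
  subst (LogAx {true}) (cong (imp (ren ρ σ (all2 k φ))) (sym (ren-inst2 φ ρ σ k Y))) (S1 k (σ k Y))
LogAx-ren ρ σ (S2 {φ} {ψ} k) =
  subst (LogAx {true}) (cong close (sym (ren-wk2 k ψ ρ σ))) (S2 k)
  where
  close : Formula true → Formula true
  close χ = imp (all2 k (imp χ (ren ρ (ext2 k σ) φ))) (imp (ren ρ σ ψ) (all2 k (ren ρ (ext2 k σ) φ)))

⊢-ren : ∀ {b} {T : Formula b → Set} → RenClosed T → ∀ {φ} ρ σ → T ⊢ φ → T ⊢ ren ρ σ φ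
⊢-ren cl ρ σ (ax p) = ax (cl ρ σ p)
⊢-ren cl ρ σ (lax p) = lax (LogAx-ren ρ σ p)
⊢-ren cl ρ σ (mp p q) = mp (⊢-ren cl ρ σ p) (⊢-ren cl ρ σ q)
⊢-ren cl ρ σ (gen p) = gen (⊢-ren cl (ext ρ) σ p)
⊢-ren cl ρ σ (gen2 k p) = gen2 k (⊢-ren cl ρ (ext2 k σ) p)

LT1+-ren : RenClosed LT1+
LT1+-ren ρ σ extAx = extAx
LT1+-ren ρ σ (sep φ) = subst LT1+ (cong same′ same) (sep (ren (ext ρ) σ φ))
  where
  same′ : Formula false → Formula false
  same′ χ = all (ex (all (iff (mem 0 1) (and (mem 0 2) χ))))
  same : ren sepρ id2 (ren (ext ρ) σ φ) ≡ ren (ext (ext (ext ρ))) σ (ren sepρ id2 φ)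
  same = trans (ren-∘ φ (λ { zero → refl ; (suc i) → refl }) (λ _ _ → refl))
               (sym (ren-∘ φ {ρ″ = λ x → ext (ext (ext ρ)) (sepρ x)} (λ _ → refl) (λ _ _ → refl)))
LT1+-ren ρ σ strat = strat
LT1+-ren ρ σ endless = endless

extN : ℕ → (ℕ → ℕ) → ℕ → ℕ
extN zero ρ = ρ
extN (suc n) ρ = extN n (ext ρ)

-- Below `n` binders the index `x + n` denotes the outer variable `x`, which alone is renamed.
extN-+ : ∀ n ρ x → extN n ρ (x + n) ≡ ρ x + n
extN-+ zero ρ x rewrite +-identityʳ x | +-identityʳ (ρ x) = refl
extN-+ (suc n) ρ x rewrite +-suc x n | +-suc (ρ x) n = extN-+ n (ext ρ) (suc x)

extN-bvars : ∀ k ρ → Vec.map (extN (suc k) ρ) (bvars k) ≡ bvars k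
extN-bvars zero ρ = refl
extN-bvars (suc k) ρ = cong₂ _∷_ (extN-+ (suc k) (ext ρ) 0) (extN-bvars k (ext ρ))

ren-allN : ∀ {b} n (φ : Formula b) ρ σ → ren ρ σ (allN n φ) ≡ allN n (ren (extN n ρ) σ φ)
ren-allN zero φ ρ σ = refl
ren-allN (suc n) φ ρ σ = cong all (ren-allN n φ (ext ρ) σ)

subsets : ∀ {b n} → Vec ℕ (suc n) → ℕ → Formula b
subsets xs y = andAll (Vec.map (λ x → subset x y) xs)

ren-subsets : ∀ {b n} (xs : Vec ℕ (suc n)) y ρ σ →
              ren {b} ρ σ (subsets xs y) ≡ subsets (Vec.map ρ xs) (ρ y)
ren-subsets (x ∷ []) y ρ σ = refl
ren-subsets (x ∷ x′ ∷ xs) y ρ σ = cong (and _) (ren-subsets (x′ ∷ xs) y ρ σ)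

ext2-zero : ∀ k σ → ext2 k σ k 0 ≡ 0
ext2-zero k σ rewrite ≡ᵇ-refl k = refl

ren-Sq : ∀ k ρ σ → ren (ext ρ) (ext2 k σ) (Sq k 0 0) ≡ Sq k 0 0
ren-Sq k ρ σ
  rewrite ren-allN (suc k) (imp (app k 0 (bvars k)) (subsets (bvars k) (suc k))) (ext ρ) (ext2 k σ)
        | ren-subsets {true} (bvars k) (suc k) (extN (suc k) (ext ρ)) (ext2 k σ)
        | ext2-zero k σ | extN-bvars k (ext ρ) | extN-+ (suc k) (ext ρ) 0 = refl

LTb+-ren : RenClosed LTb+
LTb+-ren ρ σ extAx = extAx
LTb+-ren ρ σ sep = sep
LTb+-ren ρ σ strat = strat
LTb+-ren ρ σ endless = endless
LTb+-ren ρ σ (stratb k) = subst LTb+ (cong close (sym (ren-Sq k ρ σ))) (stratb k)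
  where
  close : Formula true → Formula true
  close χ = all2 k (ex (and (Lev 0) χ))
LTb+-ren ρ σ (compb k φ) =
  subst LTb+ (sym (cong₂ close (ren-Sq k ρ σ) body)) (compb k (ren (extN (suc k) (ext ρ)) σ φ))
  where
  close : Formula true → Formula true → Formula true
  close χ χ′ = all (imp (Lev 0) (ex2 k (and χ χ′)))
  matrix : Formula true → Formula true
  matrix χ = imp (subsets (bvars k) (suc k)) (iff (app k 0 (bvars k)) χ)
  body : ren (ext ρ) (ext2 k σ) (allN (suc k) (matrix (wk2 k φ))) ≡
         allN (suc k) (matrix (wk2 k (ren (extN (suc k) (ext ρ)) σ φ)))
  body
    rewrite ren-allN (suc k) (matrix (wk2 k φ)) (ext ρ) (ext2 k σ)
          | ren-subsets {true} (bvars k) (suc k) (extN (suc k) (ext ρ)) (ext2 k σ)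
          | ext2-zero k σ | extN-bvars k (ext ρ) | extN-+ (suc k) (ext ρ) 0
          | ren-wk2 k φ (extN (suc k) (ext ρ)) σ = refl

infix 3 _⟷_
_⟷_ : Set₁ → Set₁ → Set₁
A ⟷ B = (A → B) × (B → A)

⟷-refl : ∀ {A} → A ⟷ A
⟷-refl = id , id

⟷-sym : ∀ {A B} → A ⟷ B → B ⟷ A
⟷-sym (f , g) = g , f

⟷-trans : ∀ {A B C} → A ⟷ B → B ⟷ C → A ⟷ C
⟷-trans (f , g) (f′ , g′) = f′ ∘ f , g ∘ g′

⟷-→ : ∀ {A A′ B B′} → A ⟷ A′ → B ⟷ B′ → (A → B) ⟷ (A′ → B′)
⟷-→ (f , g) (f′ , g′) = (λ h → f′ ∘ h ∘ g) , (λ h → g′ ∘ h ∘ f)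

⟷-Π : ∀ {D : Set} {P Q : D → Set₁} → (∀ d → P d ⟷ Q d) → (∀ d → P d) ⟷ (∀ d → Q d)
⟷-Π h = (λ f d → proj₁ (h d) (f d)) , (λ f d → proj₂ (h d) (f d))

⟷-≡ : ∀ {A B : Set₁} → A ≡ B → A ⟷ B
⟷-≡ refl = ⟷-refl

-- Structures for classical logic

-- R interprets falsity and may be inhabited; this freedom is what makes completeness constructive.
record FO : Set₂ where
  infix 4 _∈_ _≐_
  field
    D : Set
    _∈_ _≐_ : D → D → Set₁
    R : Set₁

-- Second-order quantifiers of arity k + 1 range over the elements of E satisfying Ok k.
record SO (A : FO) : Set₂ where
  open FO A
  field
    E : Set
    Ok : ℕ → E → Set₁
    App : (k : ℕ) → E → Vec D (suc k) → Set₁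

infixr 5 _▸_
_▸_ : {D : Set} → D → (ℕ → D) → ℕ → D
(d ▸ ρ) zero = d
(d ▸ ρ) (suc x) = ρ x

push2 : {E : Set} → ℕ → E → (ℕ → ℕ → E) → ℕ → ℕ → E
push2 k Y τ j = if j ≡ᵇ k then (Y ▸ τ j) else τ j

-- The last component becomes variable 0, in agreement with the descending list `bvars`.
pushes : {D : Set} {n : ℕ} → Vec D n → (ℕ → D) → ℕ → D
pushes [] ρ = ρ
pushes (d ∷ ds) ρ = pushes ds (d ▸ ρ)

pushes-+ : ∀ {D : Set} {n} (v : Vec D n) ρ x → pushes v ρ (x + n) ≡ ρ x
pushes-+ [] ρ x rewrite +-identityʳ x = refl
pushes-+ {n = suc n} (d ∷ ds) ρ x rewrite +-suc x n = pushes-+ ds (d ▸ ρ) (suc x)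

pushes-bvars : ∀ {D : Set} {k} (v : Vec D (suc k)) ρ → Vec.map (pushes v ρ) (bvars k) ≡ v
pushes-bvars {k = zero} (d ∷ []) ρ = refl
pushes-bvars {k = suc k} (d ∷ ds) ρ =
  cong₂ _∷_ (pushes-+ ds (d ▸ ρ) 0) (pushes-bvars ds (d ▸ ρ))

push2-ext2 : ∀ {E : Set} k (Y : E) {τ τ′ : ℕ → ℕ → E} {σ} → (∀ j i → τ j (σ j i) ≡ τ′ j i) →
             ∀ j i → push2 k Y τ j (ext2 k σ j i) ≡ push2 k Y τ′ j i
push2-ext2 k Y h j i with j ≡ᵇ k
push2-ext2 k Y h j zero | true = refl
push2-ext2 k Y h j (suc i) | true = h j i
push2-ext2 k Y h j i | false = h j i

push2-shift2 : ∀ {E : Set} k (Y : E) τ j i → push2 k Y τ j (shift2 k j i) ≡ τ j i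
push2-shift2 k Y τ j i with j ≡ᵇ k
... | true = refl
... | false = refl

push2-zero : ∀ {E : Set} k (Y : E) τ → push2 k Y τ k 0 ≡ Y
push2-zero k Y τ rewrite ≡ᵇ-refl k = refl

module Logic (A : FO) where
  open FO A public

  -- `And`, `Iff`, `Or` and `Ex` are definitionally the evaluations of `and`, `iff`, `or` and `ex`,
  -- so axioms true in a structure can be applied as functions without conversion.
  And : Set₁ → Set₁ → Set₁
  And P Q = (P → Q → R) → R

  Iff : Set₁ → Set₁ → Set₁
  Iff P Q = And (P → Q) (Q → P)

  Or : Set₁ → Set₁ → Set₁
  Or P Q = (P → R) → Q

  Ex : (D → Set₁) → Set₁
  Ex P = (∀ d → P d → R) → R

  Stable : Set₁ → Set₁
  Stable P = ((P → R) → R) → P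

  both : ∀ {P Q} → P → Q → And P Q
  both p q k = k p q

  wit : ∀ {P : D → Set₁} d → P d → Ex P
  wit d p k = k d p

  fwd : ∀ {P Q} → Stable Q → Iff P Q → P → Q
  fwd st i p = st λ k → i λ f _ → k (f p)

  bwd : ∀ {P Q} → Stable P → Iff P Q → Q → P
  bwd st i q = st λ k → i λ _ g → k (g q)

  toIff : ∀ {P Q} → P ⟷ Q → Iff P Q
  toIff (f , g) = both f g

  And-cong : ∀ {P P′ Q Q′} → P ⟷ P′ → Q ⟷ Q′ → And P Q ⟷ And P′ Q′
  And-cong p q = ⟷-→ (⟷-→ p (⟷-→ q ⟷-refl)) ⟷-refl

  Iff-cong : ∀ {P P′ Q Q′} → P ⟷ P′ → Q ⟷ Q′ → Iff P Q ⟷ Iff P′ Q′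
  Iff-cong p q = And-cong (⟷-→ p q) (⟷-→ q p)

  Ex-cong : ∀ {P Q : D → Set₁} → (∀ d → P d ⟷ Q d) → Ex P ⟷ Ex Q
  Ex-cong h = ⟷-→ (⟷-Π λ d → ⟷-→ (h d) ⟷-refl) ⟷-refl

-- Tarskian evaluation

module Eval (A : FO) (B : SO A) where
  open Logic A public
  open SO B public

  Env : Set
  Env = ℕ → D

  Env2 : Set
  Env2 = ℕ → ℕ → E

  OkEnv : Env2 → Set₁
  OkEnv τ = ∀ k i → Ok k (τ k i)

  ⟦_⟧ : ∀ {b} → Formula b → Env → Env2 → Set₁
  ⟦ mem x y ⟧ ρ τ = ρ x ∈ ρ y
  ⟦ eq x y ⟧ ρ τ = ρ x ≐ ρ y
  ⟦ bot ⟧ ρ τ = R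
  ⟦ imp φ ψ ⟧ ρ τ = ⟦ φ ⟧ ρ τ → ⟦ ψ ⟧ ρ τ
  ⟦ all φ ⟧ ρ τ = ∀ d → ⟦ φ ⟧ (d ▸ ρ) τ
  ⟦ app k i xs ⟧ ρ τ = App k (τ k i) (Vec.map ρ xs)
  ⟦ all2 k φ ⟧ ρ τ = ∀ Y → Ok k Y → ⟦ φ ⟧ ρ (push2 k Y τ)


  Models : ∀ {b} → (Formula b → Set) → Set₁
  Models T = ∀ {φ} → T φ → ∀ ρ τ → OkEnv τ → ⟦ φ ⟧ ρ τ

  record Classical : Set₁ where
    field
      ∈-stable : ∀ {x y} → Stable (x ∈ y)
      ≐-stable : ∀ {x y} → Stable (x ≐ y)
      App-stable : ∀ {k Y xs} → Stable (App k Y xs)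
      ≐-refl : ∀ {x} → x ≐ x
      ≐-sym : ∀ {x y} → x ≐ y → y ≐ x
      ≐-trans : ∀ {x y z} → x ≐ y → y ≐ z → x ≐ z
      ∈-resp : ∀ {x x′ y y′} → x ≐ x′ → y ≐ y′ → x ∈ y → x′ ∈ y′
      App-resp : ∀ {k Y xs ys} → Pointwise _≐_ xs ys → App k Y xs → App k Y ys

  eval-ren : ∀ {b} (φ : Formula b) {ρ σ} {e e′ : Env} {τ τ′ : Env2} →
             (∀ x → e (ρ x) ≡ e′ x) → (∀ j i → τ j (σ j i) ≡ τ′ j i) →
             ⟦ ren ρ σ φ ⟧ e τ ⟷ ⟦ φ ⟧ e′ τ′
  eval-ren (mem x y) h h₂ = ⟷-≡ (cong₂ _∈_ (h x) (h y))
  eval-ren (eq x y) h h₂ = ⟷-≡ (cong₂ _≐_ (h x) (h y))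
  eval-ren bot h h₂ = ⟷-refl
  eval-ren (imp φ ψ) h h₂ = ⟷-→ (eval-ren φ h h₂) (eval-ren ψ h h₂)
  eval-ren (all φ) h h₂ = ⟷-Π λ d → eval-ren φ (λ { zero → refl ; (suc x) → h x }) h₂
  eval-ren (app k i xs) h h₂ =
    ⟷-≡ (cong₂ (App k) (h₂ k i) (trans (sym (map-∘ _ _ xs)) (map-cong h xs)))
  eval-ren (all2 k φ) h h₂ = ⟷-Π λ Y → ⟷-→ ⟷-refl (eval-ren φ h (push2-ext2 k Y h₂))

  eval-scoped : ∀ {b} (φ : Formula b) {m c} {e e′ : Env} {τ τ′ : Env2} → Scoped m c φ →
                (∀ x → x < m → e x ≡ e′ x) → (∀ j i → i < c j → τ j i ≡ τ′ j i) →
                ⟦ φ ⟧ e τ ⟷ ⟦ φ ⟧ e′ τ′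
  eval-scoped (mem x y) (p , q) h h₂ = ⟷-≡ (cong₂ _∈_ (h x p) (h y q))
  eval-scoped (eq x y) (p , q) h h₂ = ⟷-≡ (cong₂ _≐_ (h x p) (h y q))
  eval-scoped bot p h h₂ = ⟷-refl
  eval-scoped (imp φ ψ) (p , q) h h₂ = ⟷-→ (eval-scoped φ p h h₂) (eval-scoped ψ q h h₂)
  eval-scoped (all φ) p h h₂ =
    ⟷-Π λ d → eval-scoped φ p (λ { zero _ → refl ; (suc x) (s≤s q) → h x q }) h₂
  eval-scoped (app k i xs) (p , ps) h h₂ =
    ⟷-≡ (cong₂ (App k) (h₂ k i p) (map-scoped xs ps h))
  eval-scoped (all2 k φ) {c = c} {τ = τ} {τ′} p h h₂ = ⟷-Π λ Y → ⟷-→ ⟷-refl (eval-scoped φ p h (agree Y))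
    where
    agree : ∀ Y j i → i < bump k c j → push2 k Y τ j i ≡ push2 k Y τ′ j i
    agree Y j i q with j ≡ᵇ k
    agree Y j zero q | true = refl
    agree Y j (suc i) (s≤s q) | true = h₂ j i q
    agree Y j i q | false = h₂ j i q

  eval-allN : ∀ {b} n (φ : Formula b) {ρ τ} →
              ⟦ allN n φ ⟧ ρ τ ⟷ ((v : Vec D n) → ⟦ φ ⟧ (pushes v ρ) τ)
  eval-allN zero φ = (λ { p [] → p }) , (λ p → p [])
  eval-allN (suc n) φ =
    (λ { p (d ∷ ds) → proj₁ (eval-allN n φ) (p d) ds }) ,
    (λ p d → proj₂ (eval-allN n φ) (λ ds → p (d ∷ ds)))

eval-emb : ∀ {A} (B B′ : SO A) φ {ρ τ τ′} → Eval.⟦_⟧ A B (emb φ) ρ τ ⟷ Eval.⟦_⟧ A B′ φ ρ τ′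
eval-emb B B′ (mem x y) = ⟷-refl
eval-emb B B′ (eq x y) = ⟷-refl
eval-emb B B′ bot = ⟷-refl
eval-emb B B′ (imp φ ψ) = ⟷-→ (eval-emb B B′ φ) (eval-emb B B′ ψ)
eval-emb B B′ (all φ) = ⟷-Π λ d → eval-emb B B′ φ

-- Soundness

module Soundness (A : FO) (B : SO A) (cl : Eval.Classical A B) where
  open Eval A B
  open Classical cl

  stable : ∀ {b} (φ : Formula b) {ρ τ} → Stable (⟦ φ ⟧ ρ τ)
  stable (mem x y) = ∈-stable
  stable (eq x y) = ≐-stable
  stable bot p = p id
  stable (imp φ ψ) p a = stable ψ λ k → p λ f → k (f a)
  stable (all φ) p d = stable φ λ k → p λ f → k (f d)
  stable (app k i xs) = App-stable
  stable (all2 k φ) p Y ok = stable φ λ c → p λ f → c (f Y ok)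

  eval-exN : ∀ {b} n (φ : Formula b) {ρ τ} →
             ⟦ exN n φ ⟧ ρ τ ⟷ (((v : Vec D n) → ⟦ φ ⟧ (pushes v ρ) τ → R) → R)
  eval-exN zero φ = (λ p k → k [] p) , (λ p → stable φ λ k → p λ { [] → k })
  eval-exN (suc n) φ =
    (λ p k → p λ d q → proj₁ (eval-exN n φ) q λ ds → k (d ∷ ds)) ,
    (λ p k → p λ { (d ∷ ds) q → k d (proj₂ (eval-exN n φ) (λ k′ → k′ ds q)) })

  eval-resp : ∀ {b} (φ : Formula b) {ρ ρ′ τ} → (∀ x → ρ x ≐ ρ′ x) → ⟦ φ ⟧ ρ τ ⟷ ⟦ φ ⟧ ρ′ τ
  eval-resp (mem x y) h = ∈-resp (h x) (h y) , ∈-resp (≐-sym (h x)) (≐-sym (h y))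
  eval-resp (eq x y) h =
    (λ p → ≐-trans (≐-sym (h x)) (≐-trans p (h y))) , (λ p → ≐-trans (h x) (≐-trans p (≐-sym (h y))))
  eval-resp bot h = ⟷-refl
  eval-resp (imp φ ψ) h = ⟷-→ (eval-resp φ h) (eval-resp ψ h)
  eval-resp (all φ) h = ⟷-Π λ d → eval-resp φ (λ { zero → ≐-refl ; (suc x) → h x })
  eval-resp (app k i xs) {ρ} {ρ′} h =
    App-resp (related xs) , App-resp (PW.sym ≐-sym (related xs))
    where
    related : ∀ {n} (xs : Vec ℕ n) → Pointwise _≐_ (Vec.map ρ xs) (Vec.map ρ′ xs)
    related [] = []
    related (x ∷ xs) = h x ∷ related xs
  eval-resp (all2 k φ) h = ⟷-Π λ Y → ⟷-→ ⟷-refl (eval-resp φ h)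

  Ok-push2 : ∀ k {Y τ} → Ok k Y → OkEnv τ → OkEnv (push2 k Y τ)
  Ok-push2 k {Y} ok oks j i with j ≡ᵇ k in e
  Ok-push2 k {Y} ok oks j zero | true = subst (λ l → Ok l Y) (sym (≡ᵇ-true e)) ok
  Ok-push2 k ok oks j (suc i) | true = oks j i
  Ok-push2 k ok oks j i | false = oks j i

  sound-ax : ∀ {b} {φ : Formula b} → LogAx φ → ∀ ρ τ → OkEnv τ → ⟦ φ ⟧ ρ τ
  sound-ax A1 ρ τ ok p q = p
  sound-ax A2 ρ τ ok p q r = p r (q r)
  sound-ax (A3 {φ = φ}) ρ τ ok = stable φ
  sound-ax (Q1 {φ = φ} x) ρ τ ok p =
    proj₂ (eval-ren φ (λ { zero → refl ; (suc i) → refl }) (λ _ _ → refl)) (p (ρ x))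
  sound-ax (Q2 {ψ = ψ}) ρ τ ok p q d = p d (proj₂ (eval-ren ψ (λ _ → refl) (λ _ _ → refl)) q)
  sound-ax (E1 x) ρ τ ok = ≐-refl
  sound-ax (E2 {φ = φ} x y) ρ τ ok p q =
    proj₂ (at y) (proj₁ (eval-resp φ (λ { zero → p ; (suc i) → ≐-refl })) (proj₁ (at x) q))
    where
    at : ∀ z → ⟦ ren (inst z) id2 φ ⟧ ρ τ ⟷ ⟦ φ ⟧ (ρ z ▸ ρ) τ
    at z = eval-ren φ (λ { zero → refl ; (suc i) → refl }) (λ _ _ → refl)
  sound-ax (S1 {φ} k Y) ρ τ ok p = proj₂ (eval-ren φ (λ _ → refl) same) (p (τ k Y) (ok k Y))
    where
    same : ∀ j i → τ j (inst2 k Y j i) ≡ push2 k (τ k Y) τ j i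
    same j i with j ≡ᵇ k in e
    same j zero | true = cong (λ l → τ l Y) (≡ᵇ-true e)
    same j (suc i) | true = refl
    same j i | false = refl
  sound-ax (S2 {ψ = ψ} k) ρ τ ok p q Y okY =
    p Y okY (proj₂ (eval-ren ψ (λ _ → refl) (push2-shift2 k Y τ)) q)

  sound : ∀ {b} {T : Formula b → Set} → Models T → ∀ {φ} → T ⊢ φ → ∀ ρ τ → OkEnv τ → ⟦ φ ⟧ ρ τ
  sound M (ax p) = M p
  sound M (lax p) = sound-ax p
  sound M (mp p q) ρ τ ok = sound M p ρ τ ok (sound M q ρ τ ok)
  sound M (gen p) ρ τ ok d = sound M p (d ▸ ρ) τ ok
  sound M (gen2 k p) ρ τ ok Y okY = sound M p ρ (push2 k Y τ) (Ok-push2 k okY ok)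

-- Enumerating formulas

-- Walks along each antidiagonal `a + c = s` from `(s , 0)` to `(0 , s)`. Only surjectivity matters,
-- so `code` is read off from its proof.
unpair : ℕ → ℕ × ℕ
unpair zero = 0 , 0
unpair (suc n) with unpair n
... | zero , c = suc c , 0
... | suc a , c = a , suc c

unpair-surjective : ∀ s a c → a + c ≡ s → Σ ℕ λ n → unpair n ≡ (a , c)
unpair-surjective s zero zero e = 0 , refl
unpair-surjective (suc s) (suc a) zero e
  with n , q ← unpair-surjective s 0 a (trans (sym (+-comm a 0)) (suc-injective e)) = suc n , step n q
  where
  step : ∀ n → unpair n ≡ (0 , a) → unpair (suc n) ≡ (suc a , 0)
  step n q rewrite q = refl
unpair-surjective s a (suc c) e
  with n , q ← unpair-surjective s (suc a) c (trans (sym (+-suc a c)) e) = suc n , step n q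
  where
  step : ∀ n → unpair n ≡ (suc a , c) → unpair (suc n) ≡ (a , suc c)
  step n q rewrite q = refl

code : ℕ → ℕ → ℕ
code a c = proj₁ (unpair-surjective (a + c) a c refl)

unpair-code : ∀ a c → unpair (code a c) ≡ (a , c)
unpair-code a c = proj₂ (unpair-surjective (a + c) a c refl)

decodeVec : (n : ℕ) → ℕ → Vec ℕ n
decodeVec zero c = []
decodeVec (suc n) c = proj₁ (unpair c) ∷ decodeVec n (proj₂ (unpair c))

decodeVec-surjective : ∀ {n} (xs : Vec ℕ n) → Σ ℕ λ c → decodeVec n c ≡ xs
decodeVec-surjective [] = 0 , refl
decodeVec-surjective (x ∷ xs) with c , e ← decodeVec-surjective xs = code x c , same
  where
  same : decodeVec _ (code x c) ≡ x ∷ xs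
  same rewrite unpair-code x c = cong (x ∷_) e

-- The first argument bounds the depth of the decoded formula.
decode : ∀ {b} → ℕ → ℕ → Formula b
decodeTag : ∀ {b} → ℕ → ℕ → ℕ → Formula b
decode f c = decodeTag f (proj₁ (unpair c)) (proj₂ (unpair c))
decodeTag f 0 c = mem (proj₁ (unpair c)) (proj₂ (unpair c))
decodeTag f 1 c = eq (proj₁ (unpair c)) (proj₂ (unpair c))
decodeTag (suc f) 2 c = imp (decode f (proj₁ (unpair c))) (decode f (proj₂ (unpair c)))
decodeTag (suc f) 3 c = all (decode f c)
decodeTag {true} f 4 c =
  app (proj₁ (unpair c)) (proj₁ (unpair (proj₂ (unpair c)))) (decodeVec _ (proj₂ (unpair (proj₂ (unpair c)))))
decodeTag {true} (suc f) 5 c = all2 (proj₁ (unpair c)) (decode f (proj₂ (unpair c)))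
decodeTag _ _ _ = bot

depth : ∀ {b} → Formula b → ℕ
depth (imp φ ψ) = suc (depth φ ⊔ depth ψ)
depth (all φ) = suc (depth φ)
depth (all2 k φ) = suc (depth φ)
depth _ = 0

decode-surjective : ∀ {b} (φ : Formula b) f → depth φ ≤ f → Σ ℕ λ c → decode f c ≡ φ
decode-tag : ∀ {b} {φ : Formula b} f t c → decodeTag f t c ≡ φ → Σ ℕ λ c → decode f c ≡ φ
decode-tag {φ = φ} f t c e = code t c , same
  where
  same : decode f (code t c) ≡ φ
  same rewrite unpair-code t c = e
decode-surjective (mem x y) f p = decode-tag f 0 (code x y) same
  where
  same : decodeTag f 0 (code x y) ≡ mem x y
  same rewrite unpair-code x y = refl
decode-surjective (eq x y) f p = decode-tag f 1 (code x y) same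
  where
  same : decodeTag f 1 (code x y) ≡ eq x y
  same rewrite unpair-code x y = refl
-- Tag 6 belongs to no other kind of formula and reaches the default clause.
decode-surjective bot f p = decode-tag f 6 0 (other f)
  where
  other : ∀ {b} f → decodeTag {b} f 6 0 ≡ bot
  other {true} zero = refl
  other {true} (suc f) = refl
  other {false} zero = refl
  other {false} (suc f) = refl
decode-surjective (imp φ ψ) (suc f) (s≤s p)
  with c , e ← decode-surjective φ f (≤-trans (m≤m⊔n _ _) p)
     | d , e′ ← decode-surjective ψ f (≤-trans (m≤n⊔m (depth φ) _) p) = decode-tag (suc f) 2 (code c d) same
  where
  same : decodeTag (suc f) 2 (code c d) ≡ imp φ ψ
  same rewrite unpair-code c d = cong₂ imp e e′
decode-surjective (all φ) (suc f) (s≤s p) with c , e ← decode-surjective φ f p =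
  decode-tag (suc f) 3 c (cong all e)
decode-surjective (app k i xs) f p with c , e ← decodeVec-surjective xs =
  decode-tag f 4 (code k (code i c)) (same f)
  where
  same : ∀ f → decodeTag f 4 (code k (code i c)) ≡ app k i xs
  same zero rewrite unpair-code k (code i c) | unpair-code i c = cong (app k i) e
  same (suc f) rewrite unpair-code k (code i c) | unpair-code i c = cong (app k i) e
decode-surjective (all2 k φ) (suc f) (s≤s p) with c , e ← decode-surjective φ f p =
  decode-tag (suc f) 5 (code k c) same
  where
  same : decodeTag (suc f) 5 (code k c) ≡ all2 k φ
  same rewrite unpair-code k c = cong (all2 k) e

enum : ∀ {b} → ℕ → Formula b
enum n = decode (proj₁ (unpair n)) (proj₂ (unpair n))

enum-surjective : ∀ {b} (φ : Formula b) → Σ ℕ λ n → enum n ≡ φ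
enum-surjective φ with c , e ← decode-surjective φ (depth φ) ≤-refl = code (depth φ) c , same
  where
  same : enum (code (depth φ) c) ≡ φ
  same rewrite unpair-code (depth φ) c = e

-- Completeness

module Deduction {b : Bool} (T : Formula b → Set) (closed : RenClosed T) where

  infixr 5 _⇛_
  -- With the head of the list as innermost antecedent, the deduction theorem is a mere change of
  -- reading.
  _⇛_ : List (Formula b) → Formula b → Formula b
  [] ⇛ φ = φ
  (γ ∷ Γ) ⇛ φ = Γ ⇛ imp γ φ

  infix 4 _⊩_
  record _⊩_ (Γ : List (Formula b)) (φ : Formula b) : Set₁ where
    constructor ⟨_⟩
    field derivation : T ⊢ (Γ ⇛ φ)
  open _⊩_ public

  deduce : ∀ {Γ γ φ} → γ ∷ Γ ⊩ φ → Γ ⊩ imp γ φ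
  deduce p = ⟨ derivation p ⟩

  assume : ∀ {Γ γ φ} → Γ ⊩ imp γ φ → γ ∷ Γ ⊩ φ
  assume p = ⟨ derivation p ⟩

  thm : ∀ {Γ φ} → T ⊢ φ → Γ ⊩ φ
  thm {[]} p = ⟨ p ⟩
  thm {γ ∷ Γ} p = assume (thm (mp (lax A1) p))

  app⊩ : ∀ {Γ φ ψ} → Γ ⊩ imp φ ψ → Γ ⊩ φ → Γ ⊩ ψ
  app⊩ {[]} ⟨ p ⟩ ⟨ q ⟩ = ⟨ mp p q ⟩
  app⊩ {γ ∷ Γ} p q = assume (app⊩ (app⊩ (thm (lax A2)) (deduce p)) (deduce q))

  imp-refl : ∀ {φ} → T ⊢ imp φ φ
  imp-refl {φ} = mp (mp (lax A2) (lax A1)) (lax (A1 {ψ = φ}))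

  hyp : ∀ {Γ φ} → φ ∈ˡ Γ → Γ ⊩ φ
  hyp (here refl) = assume (thm imp-refl)
  hyp (there p) = assume (app⊩ (thm (lax A1)) (hyp p))

  cut : ∀ {Γ Δ φ} → (∀ {γ} → γ ∈ˡ Γ → Δ ⊩ γ) → Γ ⊩ φ → Δ ⊩ φ
  cut {[]} h ⟨ p ⟩ = thm p
  cut {γ ∷ Γ} h p = app⊩ (cut (h ∘ there) (deduce p)) (h (here refl))

  weaken : ∀ {Γ Δ φ} → (∀ {γ} → γ ∈ˡ Γ → γ ∈ˡ Δ) → Γ ⊩ φ → Δ ⊩ φ
  weaken h = cut (hyp ∘ h)

  dne : ∀ {Γ φ} → neg φ ∷ Γ ⊩ bot → Γ ⊩ φ
  dne p = app⊩ (thm (lax A3)) (deduce p)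

  neg-imp-left : ∀ {Γ φ ψ} → Γ ⊩ neg (imp φ ψ) → Γ ⊩ φ
  neg-imp-left p =
    dne (app⊩ (weaken there p)
      (deduce (dne (app⊩ (hyp (there (there (here refl)))) (hyp (there (here refl)))))))

  neg-imp-right : ∀ {Γ φ ψ} → Γ ⊩ neg (imp φ ψ) → Γ ⊩ neg ψ
  neg-imp-right p = deduce (app⊩ (weaken there p) (app⊩ (thm (lax A1)) (hyp (here refl))))

  drop-trivial : ∀ {Γ φ ψ} → imp φ φ ∷ Γ ⊩ ψ → Γ ⊩ ψ
  drop-trivial p = app⊩ (deduce p) (thm imp-refl)

  ren-⇛ : ∀ ρ σ Γ φ → ren ρ σ (Γ ⇛ φ) ≡ List.map (ren ρ σ) Γ ⇛ ren ρ σ φ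
  ren-⇛ ρ σ [] φ = refl
  ren-⇛ ρ σ (γ ∷ Γ) φ = ren-⇛ ρ σ Γ (imp γ φ)

  gen⊩ : ∀ {Γ φ} → List.map wk Γ ⊩ φ → Γ ⊩ all φ
  gen⊩ {[]} ⟨ p ⟩ = ⟨ gen p ⟩
  gen⊩ {γ ∷ Γ} p = assume (app⊩ (thm (lax Q2)) (gen⊩ (deduce p)))

  -- A left inverse of inst x on formulas in which x is fresh.
  freshen : ℕ → ℕ → ℕ
  freshen x y with y ≟ x
  ... | yes _ = 0
  ... | no _ = suc y

  freshen-fresh : ∀ x → freshen x x ≡ 0
  freshen-fresh x with x ≟ x
  ... | yes _ = refl
  ... | no n = ⊥-elim (n refl)

  freshen-< : ∀ x y → y < x → freshen x y ≡ suc y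
  freshen-< x y p with y ≟ x
  ... | yes refl = ⊥-elim (<-irrefl refl p)
  ... | no _ = refl

  freshen-inst : ∀ x y → y < suc x → freshen x (inst x y) ≡ y
  freshen-inst x zero _ = freshen-fresh x
  freshen-inst x (suc y) (s≤s p) = freshen-< x y p

  map-ren : ∀ {m c ρ ρ′ σ σ′} (Γ : List (Formula b)) → All (Scoped m c) Γ →
            (∀ x → x < m → ρ x ≡ ρ′ x) → (∀ j i → i < c j → σ j i ≡ σ′ j i) →
            List.map (ren ρ σ) Γ ≡ List.map (ren ρ′ σ′) Γ
  map-ren [] [] h h₂ = refl
  map-ren (γ ∷ Γ) (s ∷ ss) h h₂ = cong₂ _∷_ (ren-scoped γ s h h₂) (map-ren Γ ss h h₂)

  -- Generalisation on a constant: `x` is fresh, so renaming the whole derivation by `freshen x`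
  -- turns `Γ` into its weakening and the instance at `x` back into `ψ`.
  gen-fresh : ∀ {Γ ψ} x → All (ScopedBelow x) (all ψ ∷ Γ) → Γ ⊩ ren (inst x) id2 ψ → Γ ⊩ all ψ
  gen-fresh {Γ} {ψ} x (s ∷ ss) ⟨ p ⟩ =
    gen⊩ ⟨ subst (T ⊢_) same (⊢-ren closed (freshen x) id2 p) ⟩
    where
    same : ren (freshen x) id2 (Γ ⇛ ren (inst x) id2 ψ) ≡ List.map wk Γ ⇛ ψ
    same = trans (ren-⇛ (freshen x) id2 Γ _)
      (cong₂ _⇛_ (map-ren Γ ss (freshen-< x) (λ _ _ _ → refl))
        (trans (ren-∘ ψ (λ _ → refl) (λ _ _ → refl))
          (trans (ren-scoped ψ s (freshen-inst x) (λ _ _ _ → refl))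
            (ren-id ψ (λ _ → refl) (λ _ _ → refl)))))

module Deduction2 (T : Formula true → Set) (closed : RenClosed T) where
  open Deduction T closed

  gen2⊩ : ∀ k {Γ φ} → List.map (wk2 k) Γ ⊩ φ → Γ ⊩ all2 k φ
  gen2⊩ k {[]} ⟨ p ⟩ = ⟨ gen2 k p ⟩
  gen2⊩ k {γ ∷ Γ} p = assume (app⊩ (thm (lax (S2 k))) (gen2⊩ k (deduce p)))

  freshen2 : ℕ → ℕ → ℕ → ℕ → ℕ
  freshen2 k x j = if j ≡ᵇ k then freshen x else id

  freshen2-< : ∀ k x j i → i < x → freshen2 k x j i ≡ shift2 k j i
  freshen2-< k x j i p with j ≡ᵇ k
  ... | true = freshen-< x i p
  ... | false = refl

  freshen2-inst2 : ∀ k x j i → i < bump k (λ _ → x) j → freshen2 k x j (inst2 k x j i) ≡ i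
  freshen2-inst2 k x j i p with j ≡ᵇ k
  ... | true = freshen-inst x i p
  ... | false = refl

  gen2-fresh : ∀ k {Γ ψ} x → All (ScopedBelow x) (all2 k ψ ∷ Γ) →
               Γ ⊩ ren id (inst2 k x) ψ → Γ ⊩ all2 k ψ
  gen2-fresh k {Γ} {ψ} x (s ∷ ss) ⟨ p ⟩ =
    gen2⊩ k ⟨ subst (T ⊢_) same (⊢-ren closed id (freshen2 k x) p) ⟩
    where
    same : ren id (freshen2 k x) (Γ ⇛ ren id (inst2 k x) ψ) ≡ List.map (wk2 k) Γ ⇛ ψ
    same = trans (ren-⇛ id (freshen2 k x) Γ _)
      (cong₂ _⇛_ (map-ren Γ ss (λ _ _ → refl) (freshen2-< k x))
        (trans (ren-∘ ψ {σ″ = λ j i → freshen2 k x j (inst2 k x j i)} (λ _ → refl) (λ _ _ → refl))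
          (trans (ren-scoped ψ {σ′ = id2} s (λ _ _ → refl) (freshen2-inst2 k x))
            (ren-id ψ (λ _ → refl) (λ _ _ → refl)))))

-- The witness axiom in contrapositive form, as `ex` is defined from `all`. Other formulas get a
-- trivial implication, so every index of the enumeration adds one axiom.
henkin : ∀ {b} → ℕ → Formula b → Formula b
henkin x (all ψ) = imp (ren (inst x) id2 ψ) (all ψ)
henkin x (all2 k ψ) = imp (ren id (inst2 k x) ψ) (all2 k ψ)
henkin x φ = imp φ φ

-- Refuting the axiom for `all ψ` proves both its instance at `x` and `neg (all ψ)`; as `x` is
-- fresh, the instance generalises and contradicts the latter.
henkin-conservative :
  ∀ {b} (T : Formula b → Set) (closed : RenClosed T) → let open Deduction T closed in
  ∀ {Γ} x φ → All (ScopedBelow x) (φ ∷ Γ) → henkin x φ ∷ Γ ⊩ bot → Γ ⊩ bot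
henkin-conservative T closed x (all ψ) s p =
  app⊩ (neg-imp-right (deduce p)) (gen-fresh x s (neg-imp-left (deduce p)))
  where open Deduction T closed
henkin-conservative T closed x (all2 k ψ) s p =
  app⊩ (neg-imp-right (deduce p)) (gen2-fresh k x s (neg-imp-left (deduce p)))
  where
  open Deduction T closed
  open Deduction2 T closed
henkin-conservative T closed x (mem y z) s p = Deduction.drop-trivial T closed p
henkin-conservative T closed x (eq y z) s p = Deduction.drop-trivial T closed p
henkin-conservative T closed x bot s p = Deduction.drop-trivial T closed p
henkin-conservative T closed x (imp φ ψ) s p = Deduction.drop-trivial T closed p
henkin-conservative T closed x (app k i xs) s p = Deduction.drop-trivial T closed p

atomTrue : ∀ {b} → (Formula b → Set₁) → (k : ℕ) → ℕ → Vec ℕ (suc k) → Set₁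
atomTrue {true} True k i xs = True (app k i xs)
atomTrue {false} True k i xs = ⊤

module Completeness {b : Bool} (T : Formula b → Set) (closed : RenClosed T) (goal : Formula b) where
  open Deduction T closed

  listBound : List (Formula b) → ℕ
  listBound [] = 0
  listBound (φ ∷ Γ) = bound φ ⊔ listBound Γ

  scoped-listBound : ∀ Γ → All (ScopedBelow (listBound Γ)) Γ
  scoped-listBound [] = []
  scoped-listBound (φ ∷ Γ) =
    ScopedBelow-mono φ (m≤m⊔n _ _) (scoped-bound φ) ∷
    All.map (λ {γ} → ScopedBelow-mono γ (m≤n⊔m (bound φ) _)) (scoped-listBound Γ)

  witness : List (Formula b) → ℕ → ℕ
  witness Γ n = listBound (enum n ∷ Γ)

  henkins : ℕ → List (Formula b)
  henkins zero = neg goal ∷ []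
  henkins (suc n) = henkin (witness (henkins n) n) (enum n) ∷ henkins n

  -- Stands in for absurdity: the consistency lemmas return this derivation instead of a
  -- contradiction, and `complete` turns it into a proof of `goal`.
  Inconsistent : Set₁
  Inconsistent = neg goal ∷ [] ⊩ bot

  henkins-consistent : ∀ n → henkins n ⊩ bot → Inconsistent
  henkins-consistent zero p = p
  henkins-consistent (suc n) p =
    henkins-consistent n (henkin-conservative T closed _ (enum n) (scoped-listBound (enum n ∷ henkins n)) p)

  henkins-mono : ∀ {m n φ} → m ≤′ n → φ ∈ˡ henkins m → φ ∈ˡ henkins n
  henkins-mono ≤′-refl p = p
  henkins-mono (≤′-step q) p = there (henkins-mono q p)

  infix 4 _⊪_
  _⊪_ : (Formula b → Set₁) → Formula b → Set₁
  P ⊪ φ = Σ (List (Formula b)) λ Γ → All P Γ × Γ ⊩ φ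

  -- Lindenbaum's extension, except that consistency is not decided:
  -- enum n is a member as soon as its refutability would make the starting point inconsistent.
  Stage : ℕ → Formula b → Set₁
  Stage zero φ = Lift _ (Σ ℕ λ n → φ ∈ˡ henkins n)
  Stage (suc n) φ = Stage n φ ⊎ (φ ≡ enum n × (Stage n ⊪ neg (enum n) → Inconsistent))

  Stage-mono : ∀ {m n φ} → m ≤′ n → Stage m φ → Stage n φ
  Stage-mono ≤′-refl p = p
  Stage-mono (≤′-step q) p = inj₁ (Stage-mono q p)

  collect : ∀ Γ → All (Stage 0) Γ → Σ ℕ λ n → ∀ {γ} → γ ∈ˡ Γ → γ ∈ˡ henkins n
  collect [] [] = 0 , λ ()
  collect (γ ∷ Γ) (lift (m , p) ∷ ps) with n , h ← collect Γ ps =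
    m ⊔ n , λ { (here refl) → henkins-mono (≤⇒≤′ (m≤m⊔n m n)) p
              ; (there q) → henkins-mono (≤⇒≤′ (m≤n⊔m m n)) (h q) }

  split : ∀ n Γ → All (Stage (suc n)) Γ →
          All (Stage n) Γ ⊎ ((Stage n ⊪ neg (enum n) → Inconsistent) ×
            Σ (List (Formula b)) λ Δ → All (Stage n) Δ × (∀ {γ} → γ ∈ˡ Γ → γ ∈ˡ enum n ∷ Δ))
  split n [] [] = inj₁ []
  split n (γ ∷ Γ) (p ∷ ps) with p | split n Γ ps
  ... | inj₁ q | inj₁ qs = inj₁ (q ∷ qs)
  ... | inj₁ q | inj₂ (c , Δ , qs , h) =
    inj₂ (c , γ ∷ Δ , q ∷ qs , λ { (here refl) → there (here refl) ; (there r) → insert (h r) })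
    where
    insert : ∀ {φ} → φ ∈ˡ enum n ∷ Δ → φ ∈ˡ enum n ∷ γ ∷ Δ
    insert (here e) = here e
    insert (there r) = there (there r)
  ... | inj₂ (refl , c) | inj₁ qs = inj₂ (c , Γ , qs , id)
  ... | inj₂ (refl , c) | inj₂ (_ , Δ , qs , h) =
    inj₂ (c , Δ , qs , λ { (here refl) → here refl ; (there r) → h r })

  stage-consistent : ∀ n → Stage n ⊪ bot → Inconsistent
  stage-consistent zero (Γ , ps , d) with n , h ← collect Γ ps = henkins-consistent n (weaken h d)
  stage-consistent (suc n) (Γ , ps , d) with split n Γ ps
  ... | inj₁ qs = stage-consistent n (Γ , qs , d)
  ... | inj₂ (c , Δ , qs , h) = c (Δ , qs , deduce (weaken h d))

  True : Formula b → Set₁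
  True φ = Σ ℕ λ n → Stage n ⊪ φ

  true-consistent : True bot → Inconsistent
  true-consistent (n , p) = stage-consistent n p

  true-app : ∀ {φ ψ} → True (imp φ ψ) → True φ → True ψ
  true-app (m , Γ , ps , d) (n , Δ , qs , e) =
    m ⊔ n , Γ ++ Δ ,
    ++⁺ (All.map (Stage-mono (≤⇒≤′ (m≤m⊔n m n))) ps) (All.map (Stage-mono (≤⇒≤′ (m≤n⊔m m n))) qs) ,
    app⊩ (weaken ∈-++⁺ˡ d) (weaken (∈-++⁺ʳ Γ) e)

  true-map : ∀ {φ ψ} → (∀ {Γ} → Γ ⊩ φ → Γ ⊩ ψ) → True φ → True ψ
  true-map f (n , Γ , ps , d) = n , Γ , ps , f d

  true-thm : ∀ {φ} → T ⊢ φ → True φ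
  true-thm p = 0 , [] , [] , ⟨ p ⟩

  true-member : ∀ n {φ} → Stage n φ → True φ
  true-member n p = n , _ ∷ [] , p ∷ [] , hyp (here refl)

  -- Composing `h` with `true-consistent` gives the certificate that admits `φ` at its own index.
  -- This replaces the choice between `φ` and `neg φ`; stability and the clause for implication
  -- follow from it.
  true-maximal : ∀ φ → (True (neg φ) → True bot) → True φ
  true-maximal φ h with n , refl ← enum-surjective φ =
    true-member (suc n) (inj₂ (refl , λ p → true-consistent (h (n , p))))

  true-imp : ∀ {φ ψ} → (True φ → True ψ) → True (imp φ ψ)
  true-imp h = true-maximal _ λ p →
    true-app (true-map neg-imp-right p) (h (true-map neg-imp-left p))

  henkin-true : ∀ φ → Σ ℕ λ x → True (henkin x φ)
  henkin-true φ with n , refl ← enum-surjective φ =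
    _ , true-member 0 (lift (suc n , here refl))

  true-stable : ∀ {φ} → ((True φ → True bot) → True bot) → True φ
  true-stable {φ} h = true-maximal φ λ p → h (true-app p)

  termFO : FO
  termFO = record { D = ℕ ; _∈_ = λ x y → True (mem x y) ; _≐_ = λ x y → True (eq x y) ; R = True bot }

  termSO : SO termFO
  termSO = record { E = ℕ ; Ok = λ _ _ → ⊤ ; App = atomTrue True }

  open Eval termFO termSO

  true-all : ∀ {ψ} → (∀ x → True (ren (inst x) id2 ψ)) → True (all ψ)
  true-all {ψ} h with x , p ← henkin-true (all ψ) = true-app p (h x)

  true-inst : ∀ {ψ} x → True (all ψ) → True (ren (inst x) id2 ψ)
  true-inst x = true-app (true-thm (lax (Q1 x)))

  true-resp : ∀ φ x y → True (eq x y) → True (ren (inst x) id2 φ) → True (ren (inst y) id2 φ)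
  true-resp φ x y p = true-app (true-app (true-thm (lax (E2 {φ = φ} x y))) p)

  true-refl : ∀ {x} → True (eq x x)
  true-refl {x} = true-thm (lax (E1 x))

  true-sym : ∀ {x y} → True (eq x y) → True (eq y x)
  true-sym {x} {y} p = true-resp (eq 0 (suc x)) x y p true-refl

  true-trans : ∀ {x y z} → True (eq x y) → True (eq y z) → True (eq x z)
  true-trans {x} {y} {z} p q = true-resp (eq (suc x) 0) y z q p

  true-∈ : ∀ {x x′ y y′} → True (eq x x′) → True (eq y y′) → True (mem x y) → True (mem x′ y′)
  true-∈ {x} {x′} {y} {y′} p q r =
    true-resp (mem (suc x′) 0) y y′ q (true-resp (mem 0 (suc y)) x x′ p r)

  -- E2 substitutes for a single variable, so equal vectors are exchanged one coordinate at a time.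
  coordinatewise : ∀ {n} (P : Vec ℕ n → Set₁) →
    (∀ v x y → True (eq x y) → P (Vec.map (inst x) v) → P (Vec.map (inst y) v)) →
    ∀ {xs ys} → Pointwise (λ x y → True (eq x y)) xs ys → P xs → P ys
  coordinatewise P h [] p = p
  coordinatewise P h {x ∷ xs} {y ∷ _} (q ∷ qs) p =
    coordinatewise (λ v → P (y ∷ v)) (λ v → h (suc y ∷ v)) qs
      (subst (λ v → P (y ∷ v)) (unlift y)
        (h (0 ∷ Vec.map suc xs) x y q (subst (λ v → P (x ∷ v)) (sym (unlift x)) p)))
    where
    unlift : ∀ z → Vec.map (inst z) (Vec.map suc xs) ≡ xs
    unlift z = trans (sym (map-∘ (inst z) suc xs)) (map-id xs)

atom-stable : ∀ {b} (T : Formula b → Set) (closed : RenClosed T) goal →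
  let open Completeness T closed goal; open Eval termFO termSO in
  ∀ {k Y xs} → Stable (App k Y xs)
atom-stable {true} T closed goal = true-stable
  where open Completeness T closed goal
atom-stable {false} T closed goal = λ _ → _

atom-resp : ∀ {b} (T : Formula b → Set) (closed : RenClosed T) goal →
  let open Completeness T closed goal; open Eval termFO termSO in
  ∀ {k Y xs ys} → Pointwise _≐_ xs ys → App k Y xs → App k Y ys
atom-resp {true} T closed goal {k} {Y} =
  coordinatewise (λ v → True (app k Y v)) (λ v → true-resp (app k Y v))
  where open Completeness T closed goal
atom-resp {false} T closed goal = _

-- Terms are variables, so an environment of the term model is itself a renaming. The quantifier
-- cases use Henkin axioms in one direction, `Q1` and `S1` in the other.
truth : ∀ {b} (T : Formula b → Set) (closed : RenClosed T) goal →
  let open Completeness T closed goal; open Eval termFO termSO in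
  ∀ (φ : Formula b) {ρ τ} → ⟦ φ ⟧ ρ τ ⟷ True (ren ρ τ φ)
truth T closed goal (mem x y) = ⟷-refl
truth T closed goal (eq x y) = ⟷-refl
truth T closed goal bot = ⟷-refl
truth T closed goal (imp φ ψ) =
  (λ f → true-imp (proj₁ (truth T closed goal ψ) ∘ f ∘ proj₂ (truth T closed goal φ))) ,
  (λ p → proj₂ (truth T closed goal ψ) ∘ true-app p ∘ proj₁ (truth T closed goal φ))
  where open Completeness T closed goal
truth T closed goal (all φ) {ρ} {τ} =
  (λ f → true-all λ x → subst True (sym (at x)) (proj₁ (truth T closed goal φ) (f x))) ,
  (λ p x → proj₂ (truth T closed goal φ) (subst True (at x) (true-inst x p)))
  where
  open Completeness T closed goal
  at : ∀ x → ren (inst x) id2 (ren (ext ρ) τ φ) ≡ ren (x ▸ ρ) τ φ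
  at x = ren-∘ φ (λ { zero → refl ; (suc i) → refl }) (λ _ _ → refl)
truth T closed goal (app k i xs) = ⟷-refl
truth T closed goal (all2 k φ) {ρ} {τ} =
  (λ f → let x , p = henkin-true (all2 k (ren ρ (ext2 k τ) φ)) in
         true-app p (subst True (sym (at x)) (proj₁ (truth T closed goal φ) (f x _)))) ,
  (λ p x _ → proj₂ (truth T closed goal φ) (subst True (at x) (true-app (true-thm (lax (S1 k x))) p)))
  where
  open Completeness T closed goal
  same : ∀ x j i → inst2 k x j (ext2 k τ j i) ≡ push2 k x τ j i
  same x j i with j ≡ᵇ k
  same x j zero | true = refl
  same x j (suc i) | true = refl
  same x j i | false = refl
  at : ∀ x → ren id (inst2 k x) (ren ρ (ext2 k τ) φ) ≡ ren ρ (push2 k x τ) φ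
  at x = ren-∘ φ (λ _ → refl) (same x)

complete : ∀ {b} {T : Formula b → Set} → RenClosed T → ∀ φ →
  (∀ A B → let open Eval A B in Classical → Models T → ∀ ρ τ → OkEnv τ → ⟦ φ ⟧ ρ τ) → T ⊢ φ
complete {T = T} closed φ valid =
  -- A refutation of `neg φ` is, once its context is unfolded, a derivation of `neg (neg φ)`.
  mp (lax A3) (derivation (true-consistent (true-app (true-member 0 (lift (0 , here refl))) φ-true)))
  where
  open Deduction T closed
  open Completeness T closed φ
  open Eval termFO termSO
  classical : Classical
  classical = record
    { ∈-stable = true-stable ; ≐-stable = true-stable ; App-stable = atom-stable T closed φ
    ; ≐-refl = true-refl ; ≐-sym = true-sym ; ≐-trans = true-trans
    ; ∈-resp = true-∈ ; App-resp = atom-resp T closed φ }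
  φ-true : True φ
  φ-true = subst True (ren-id φ (λ _ → refl) (λ _ _ → refl))
    (proj₁ (truth T closed φ φ)
      (valid termFO termSO classical
        (λ {ψ} p ρ τ _ → proj₂ (truth T closed φ ψ) (true-thm (ax (closed ρ τ p))))
        id id2 (λ _ _ → _)))

-- Level theory inside a structure

module Sets (A : FO) where
  open Logic A

  infix 4 _⊆_
  _⊆_ : D → D → Set₁
  x ⊆ y = ∀ z → z ∈ x → z ∈ y

  -- `IsHist`, `IsPot`, `IsLev`, `IsSing` and `IsDoub` are definitionally the evaluations of `Hist`,
  -- `PotEq`, `Lev`, `Sing` and `Doub`, which can therefore stand in Separation instances directly.
  IsHist : D → Set₁
  IsHist h = ∀ x → x ∈ h → ∀ y → Iff (y ∈ x) (Ex λ c → And (c ∈ x) (And (c ∈ h) (y ⊆ c)))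

  IsPot : D → D → Set₁
  IsPot s h = ∀ x → Iff (x ∈ s) (Ex λ c → And (c ∈ h) (x ⊆ c))

  IsLev : D → Set₁
  IsLev s = Ex λ h → And (IsHist h) (IsPot s h)

  Potent : D → Set₁
  Potent s = ∀ {x y} → x ∈ s → y ⊆ x → y ∈ s

  Transitive : D → Set₁
  Transitive s = ∀ x → x ∈ s → x ⊆ s

  IsSing : D → D → Set₁
  IsSing w a = ∀ x → Iff (x ∈ w) (x ≐ a)

  IsDoub : D → D → D → Set₁
  IsDoub w a c = ∀ x → Iff (x ∈ w) (Or (x ≐ a) (x ≐ c))

  -- From `z ∈ x ⊆ c ∈ h`, the history property at `c` yields `d ∈ h` with `z ⊆ d`. Kept apart from
  -- `LevelTheory` because deriving Separation in models of `LTb+` relies on it.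
  level-transitive : (∀ {x y} → Stable (x ∈ y)) → ∀ {s} → IsLev s → Transitive s
  level-transitive ∈-stable ls x x∈s z z∈x = ∈-stable λ k →
    ls λ h p → p λ H P → P x λ f _ → f x∈s λ c q → q λ c∈h x⊆c →
    H c c∈h z λ g _ → g (x⊆c z z∈x) λ d q → q λ d∈c q → q λ d∈h z⊆d →
    P z λ _ f′ → k (f′ (wit d (both d∈h z⊆d)))

module Theory (A : FO) (B : SO A) where
  open Eval A B
  open Sets A

  -- The common ground of both kinds of models. Separation covers second-order formulas so that sets
  -- of tuples can be cut out by relations with second-order parameters.
  record LevelTheory : Set₁ where
    field
      classical : Classical
      ρ₀ : Env
      τ₀ : Env2
      ok₀ : OkEnv τ₀
      extensionality : ∀ a c → (∀ x → Iff (x ∈ a) (x ∈ c)) → a ≐ c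
      separation : ∀ (φ : Formula true) ρ τ → OkEnv τ → ∀ a →
        Ex λ c → ∀ x → Iff (x ∈ c) (And (x ∈ a) (⟦ φ ⟧ (x ▸ ρ) τ))
      stratification : ∀ a → Ex λ s → And (IsLev s) (a ⊆ s)
      endlessness : ∀ s → IsLev s → Ex λ t → And (IsLev t) (s ∈ t)

module Levels (A : FO) (B : SO A) (L : Theory.LevelTheory A B) where
  open Eval A B
  open Sets A
  open Theory.LevelTheory L
  open Classical classical
  open Soundness A B classical

  separate : ∀ (φ : Formula true) ρ a → Ex λ c → ∀ x → Iff (x ∈ c) (And (x ∈ a) (⟦ φ ⟧ (x ▸ ρ) τ₀))
  separate φ ρ a = separation φ ρ τ₀ ok₀ a

  lev-transitive : ∀ {s} → IsLev s → Transitive s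
  lev-transitive = level-transitive ∈-stable

  pot-potent : ∀ {s h} → IsPot s h → Potent s
  pot-potent P {x} {y} x∈s y⊆x = ∈-stable λ k →
    P x λ f _ → f x∈s λ c q → q λ c∈h x⊆c →
    P y λ _ f′ → k (f′ (wit c (both c∈h (λ z → x⊆c z ∘ y⊆x z))))

  lev-potent : ∀ {s} → IsLev s → Potent s
  lev-potent ls x∈s y⊆x = ∈-stable λ k → ls λ h p → p λ H P → k (pot-potent P x∈s y⊆x)

  hist-potent : ∀ {h c} → IsHist h → c ∈ h → Potent c
  hist-potent {h} {c} H c∈h {x} {y} x∈c y⊆x = ∈-stable λ k →
    H c c∈h x λ f _ → f x∈c λ d q → q λ d∈c q → q λ d∈h x⊆d →
    H c c∈h y λ _ g → k (g (wit d (both d∈c (both d∈h (λ z → x⊆d z ∘ y⊆x z)))))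

  -- Foundation for classes of potent sets: for d = {x : x ∉ x and x lies in every member of the class},
  -- a member r with d ∉ r exists, and it is minimal because d ⊆ t ∈ r would give d ∈ r.
  minimal : ∀ (φ : Formula true) ρ → (∀ r → ⟦ φ ⟧ (r ▸ ρ) τ₀ → Potent r) → ∀ s → ⟦ φ ⟧ (s ▸ ρ) τ₀ →
            Ex λ r → And (⟦ φ ⟧ (r ▸ ρ) τ₀) (∀ t → ⟦ φ ⟧ (t ▸ ρ) τ₀ → t ∈ r → R)
  minimal φ ρ potent s φs k =
    separate (and (neg (mem 0 0)) (all (imp (ren (ext suc) id2 φ) (mem 1 0)))) ρ s λ d spec →
    let above : ∀ x r → ⟦ ren (ext suc) id2 φ ⟧ (r ▸ x ▸ ρ) τ₀ ⟷ ⟦ φ ⟧ (r ▸ ρ) τ₀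
        above x r = eval-ren φ (λ { zero → refl ; (suc i) → refl }) (λ _ _ → refl)
        below : ∀ t → ⟦ φ ⟧ (t ▸ ρ) τ₀ → d ⊆ t
        below t φt x x∈d = ∈-stable λ k′ →
          spec x λ f _ → f x∈d λ _ q → q λ _ q → k′ (q t (proj₂ (above x t) φt))
        member : ∀ r → ⟦ φ ⟧ (r ▸ ρ) τ₀ → d ∈ r
        member r φr = ∈-stable λ d∉r →
          k r (both φr (λ t φt t∈r → d∉r (potent r φr t∈r (below t φt))))
        d∉d : d ∈ d → R
        d∉d d∈d = spec d λ f _ → f d∈d λ _ q → q λ n _ → n d∈d
    in spec d λ _ g →
       d∉d (g (both (member s φs) (both d∉d (λ r φr → member r (proj₁ (above d r) φr)))))

  -- Let `r` be a minimal non-transitive member of `h` and `z ∈ x ∈ r`. Then `x ⊆ e` for some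
  -- `e ∈ r` in `h`, and `z ⊆ d` for some `d ∈ e` in `h`. Minimality makes `e` transitive, so
  -- `d ⊆ e ∈ r`; potency of `r` gives `d ∈ r` and then `z ∈ r`.
  hist-transitive : ∀ {h c} → IsHist h → c ∈ h → Transitive c
  hist-transitive {h} {c} H c∈h x x∈c z z∈x = ∈-stable λ z∉c →
    minimal bad (h ▸ ρ₀) (λ r q {_} {_} x∈r y⊆x → ∈-stable λ k → q λ r∈h _ → k (hist-potent H r∈h x∈r y⊆x))
      c (both c∈h (λ tr → z∉c (tr x x∈c z z∈x))) λ r q → q λ badr min → badr λ r∈h ¬tr →
      ¬tr λ x x∈r z z∈x → ∈-stable λ z∉r →
        H r r∈h x λ f _ → f x∈r λ e q → q λ e∈r q → q λ e∈h x⊆e →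
        H e e∈h z λ g _ → g (x⊆e z z∈x) λ d q → q λ d∈e q → q λ d∈h z⊆d →
        min e (both e∈h (λ tr → z∉r (hist-potent H r∈h (hist-potent H r∈h e∈r (tr d d∈e)) z⊆d))) e∈r
    where
    bad : Formula true
    bad = and (mem 0 1) (neg (all (imp (mem 0 1) (subset 0 1))))

  -- The witness `g` is the intersection of `c` and `h`. As `c` is transitive, each `x ∈ g` has the
  -- same members in `g` as in `h`, so `g` inherits the history property.
  hist-lev : ∀ {h c} → IsHist h → c ∈ h → IsLev c
  hist-lev {h} {c} H c∈h k =
    separate (mem 0 1) (h ▸ ρ₀) c λ g spec →
    let into : ∀ {d} → d ∈ c → d ∈ h → d ∈ g
        into d∈c d∈h = ∈-stable λ k′ → spec _ λ _ f → k′ (f (both d∈c d∈h))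
        outof : ∀ {d} → d ∈ g → And (d ∈ c) (d ∈ h)
        outof d∈g k′ = spec _ λ f _ → f d∈g k′
        hist : IsHist g
        hist x x∈g y k′ = k′
          (λ y∈x k″ → outof x∈g λ x∈c x∈h → H x x∈h y λ f _ → f y∈x λ d q → q λ d∈x q → q λ d∈h y⊆d →
            k″ d (both d∈x (both (into (hist-transitive H c∈h x x∈c d d∈x) d∈h) y⊆d)))
          (λ p → ∈-stable λ k″ → outof x∈g λ x∈c x∈h → p λ d q → q λ d∈x q → q λ d∈g y⊆d →
            outof d∈g λ _ d∈h → H x x∈h y λ _ f → k″ (f (wit d (both d∈x (both d∈h y⊆d)))))
        pot : IsPot c g
        pot y k′ = k′
          (λ y∈c k″ → H c c∈h y λ f _ → f y∈c λ d q → q λ d∈c q → q λ d∈h y⊆d →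
            k″ d (both (into d∈c d∈h) y⊆d))
          (λ p → ∈-stable λ k″ → p λ d q → q λ d∈g y⊆d → outof d∈g λ d∈c d∈h →
            H c c∈h y λ _ f → k″ (f (wit d (both d∈c (both d∈h y⊆d)))))
    in k g (both hist pot)

  lev-accumulates : ∀ {s x} → IsLev s → x ∈ s → Ex λ r → And (IsLev r) (And (r ∈ s) (x ⊆ r))
  lev-accumulates {s} {x} ls x∈s k =
    ls λ h p → p λ H P → P x λ f _ → f x∈s λ c q → q λ c∈h x⊆c →
    P c λ _ g → k c (both (hist-lev H c∈h) (both (g (wit c (both c∈h (λ _ → id)))) x⊆c))

  Comparable : D → D → Set₁
  Comparable s t = (s ∈ t → R) → (s ≐ t → R) → (t ∈ s → R) → R

  -- Two nested minimal choices: `s` among levels incomparable with some level, then `t` among those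
  -- incomparable with `s`. A level `r ∈ s` is comparable with `t`, and `r ≐ t` or `t ∈ r` would
  -- give `t ∈ s`; so `r ∈ t`, and symmetrically. Levels being determined by the levels in them,
  -- `s ≐ t`.
  comparable : ∀ {s t} → IsLev s → IsLev t → Comparable s t
  comparable {s} {t} ls lt n₁ n₂ n₃ =
    minimal bad₁ ρ₀ (λ r q {_} {_} → potent r q) s
      (both ls (wit t (both lt (λ c → c n₁ n₂ n₃)))) λ s p → p λ bads min₁ → bads λ ls q → q λ t q → q λ lt inc →
    minimal bad₂ (s ▸ ρ₀) (λ r q {_} {_} → potent r q) t (both lt inc) λ t p → p λ badt min₂ → badt λ lt inc →
    inc λ n₁ n₂ n₃ →
    let below-s : ∀ r → IsLev r → r ∈ s → r ∈ t
        below-s r lr r∈s = ∈-stable λ k → min₁ r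
          (both lr (wit t (both lt λ c → c k (λ r≐t → n₃ (∈-resp r≐t ≐-refl r∈s))
            (λ t∈r → n₃ (lev-transitive ls r r∈s t t∈r))))) r∈s
        below-t : ∀ r → IsLev r → r ∈ t → r ∈ s
        below-t r lr r∈t = ∈-stable λ k → min₂ r
          (both lr (λ c → c (λ s∈r → n₁ (lev-transitive lt r r∈t s s∈r))
            (λ s≐r → n₁ (∈-resp (≐-sym s≐r) ≐-refl r∈t)) k)) r∈t
        s⊆t : s ⊆ t
        s⊆t x x∈s = ∈-stable λ k → lev-accumulates ls x∈s λ r q → q λ lr q → q λ r∈s x⊆r →
          k (lev-potent lt (below-s r lr r∈s) x⊆r)
        t⊆s : t ⊆ s
        t⊆s x x∈t = ∈-stable λ k → lev-accumulates lt x∈t λ r q → q λ lr q → q λ r∈t x⊆r →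
          k (lev-potent ls (below-t r lr r∈t) x⊆r)
    in n₂ (extensionality s t λ x → both (s⊆t x) (t⊆s x))
    where
    cmp : ℕ → ℕ → Formula true
    cmp x y = imp (neg (mem x y)) (imp (neg (eq x y)) (imp (neg (mem y x)) bot))
    bad₁ bad₂ : Formula true
    bad₁ = and (Lev 0) (ex (and (Lev 0) (neg (cmp 1 0))))
    bad₂ = and (Lev 0) (neg (cmp 1 0))
    potent : ∀ r {Q} → And (IsLev r) Q → Potent r
    potent r q x∈r y⊆x = ∈-stable λ k → q λ lr _ → k (lev-potent lr x∈r y⊆x)

  -- Endless turns the inclusion given by Stratification into membership; the larger of two
  -- comparable levels then contains both sets.
  common-level : ∀ a c → Ex λ t → And (IsLev t) (And (a ∈ t) (c ∈ t))
  common-level a c k =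
    above a λ s q → q λ ls a∈s → above c λ t q → q λ lt c∈t →
    comparable ls lt
      (λ s∈t → k t (both lt (both (lev-transitive lt s s∈t a a∈s) c∈t)))
      (λ s≐t → k t (both lt (both (∈-resp ≐-refl s≐t a∈s) c∈t)))
      (λ t∈s → k s (both ls (both a∈s (lev-transitive ls t t∈s c c∈t))))
    where
    above : ∀ a → Ex λ s → And (IsLev s) (a ∈ s)
    above a k = stratification a λ s q → q λ ls a⊆s → endlessness s ls λ t q → q λ lt s∈t →
      k t (both lt (lev-potent lt s∈t a⊆s))

  doubleton : ∀ a c → Ex λ w → IsDoub w a c
  doubleton a c k =
    common-level a c λ t q → q λ lt q → q λ a∈t c∈t →
    separate (or (eq 0 1) (eq 0 2)) (a ▸ c ▸ ρ₀) t λ w spec →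
    k w λ x → both
      (λ x∈w n → ≐-stable λ j → spec x λ f _ → f x∈w λ _ p → j (p n))
      (λ p → ∈-stable λ j → spec x λ _ g → j (g (both (inside a∈t c∈t p) p)))
    where
    inside : ∀ {x t} → a ∈ t → c ∈ t → Or (x ≐ a) (x ≐ c) → x ∈ t
    inside a∈t c∈t p = ∈-stable λ j →
      j (∈-resp (≐-sym (p λ x≐a → j (∈-resp (≐-sym x≐a) ≐-refl a∈t))) ≐-refl c∈t)

  singleton : ∀ a → Ex λ w → IsSing w a
  singleton a k = doubleton a a λ w dw → k w λ x → both
    (λ x∈w → ≐-stable λ j → dw x λ f _ → j (f x∈w j))
    (λ x≐a → ∈-stable λ j → dw x λ _ g → j (g λ _ → x≐a))

-- Kuratowski tuples

module Tuples (A : FO) where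
  open Logic A
  open Sets A

  IsPairOf : D → D → D → Set₁
  IsPairOf z a c = ∀ w → Iff (w ∈ z) (Or (IsSing w a) (IsDoub w a c))

  Tup : ∀ {k} → D → Vec D (suc k) → Set₁
  Tup z (x ∷ []) = z ≐ x
  Tup z (x ∷ y ∷ ys) = Ex λ w → And (Tup w (y ∷ ys)) (IsPairOf z x w)

  TupIn : ∀ {k} → Vec D (suc k) → D → Set₁
  TupIn xs a = Ex λ z → And (Tup z xs) (z ∈ a)

  IsTuple : ℕ → D → Set₁
  IsTuple k z = ((v : Vec D (suc k)) → Tup z v → R) → R

  IsTupSet : ℕ → D → Set₁
  IsTupSet k a = ∀ z → z ∈ a → IsTuple k z

  infix 4 _⊑_
  _⊑_ : ∀ {n} → Vec D n → D → Set₁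
  v ⊑ s = VAll.All (_⊆ s) v

pushes-extN : ∀ {D : Set} {n} (v : Vec D n) {r} {e e′ : ℕ → D} → (∀ x → e (r x) ≡ e′ x) →
              ∀ x → pushes v e (extN n r x) ≡ pushes v e′ x
pushes-extN [] h x = h x
pushes-extN (d ∷ ds) h x = pushes-extN ds (λ { zero → refl ; (suc x) → h x }) x

module TupleEval (A : FO) (B : SO A) (cl : Eval.Classical A B) where
  open Eval A B
  open Sets A
  open Tuples A
  open Classical cl
  open Soundness A B cl

  All-stable : ∀ {P : D → Set₁} {n} (v : Vec D n) → (∀ {x} → Stable (P x)) → Stable (VAll.All P v)
  All-stable [] st p = []
  All-stable (x ∷ v) st p =
    st (λ k → p λ { (q ∷ _) → k q }) ∷ All-stable v st (λ k → p λ { (_ ∷ qs) → k qs })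

  ⊆-stable : ∀ {x y} → Stable (x ⊆ y)
  ⊆-stable p z z∈x = ∈-stable λ k → p λ x⊆y → k (x⊆y z z∈x)

  ⊑-stable : ∀ {n} {v : Vec D n} {s} → Stable (v ⊑ s)
  ⊑-stable = All-stable _ ⊆-stable

  eval-IsTup : ∀ {b k} z (xs : Vec ℕ (suc k)) {ρ τ} → ⟦ IsTup {b} z xs ⟧ ρ τ ⟷ Tup (ρ z) (Vec.map ρ xs)
  eval-IsTup z (x ∷ []) = ⟷-refl
  eval-IsTup z (x ∷ y ∷ ys) {ρ} = Ex-cong λ d → And-cong
    (⟷-trans (eval-IsTup 0 (Vec.map suc (y ∷ ys)))
      (⟷-≡ (cong (Tup d) (sym (map-∘ (d ▸ ρ) suc (y ∷ ys))))))
    ⟷-refl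

  eval-TupMem : ∀ {b k} (xs : Vec ℕ (suc k)) a {ρ τ} → ⟦ TupMem {b} xs a ⟧ ρ τ ⟷ TupIn (Vec.map ρ xs) (ρ a)
  eval-TupMem xs a {ρ} = Ex-cong λ d → And-cong
    (⟷-trans (eval-IsTup 0 (Vec.map suc xs)) (⟷-≡ (cong (Tup d) (sym (map-∘ (d ▸ ρ) suc xs)))))
    ⟷-refl

  eval-IsTupleN : ∀ {b} k z {ρ τ} → ⟦ IsTupleN {b} k z ⟧ ρ τ ⟷ IsTuple k (ρ z)
  eval-IsTupleN k z {ρ} = ⟷-trans (eval-exN (suc k) (IsTup (z + suc k) (bvars k)))
    ((λ p n → p λ v q → n v (proj₁ (at v) q)) , (λ p n → p λ v q → n v (proj₂ (at v) q)))
    where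
    at : ∀ v {b τ} → ⟦ IsTup {b} (z + suc k) (bvars k) ⟧ (pushes v ρ) τ ⟷ Tup (ρ z) v
    at v = ⟷-trans (eval-IsTup (z + suc k) (bvars k))
      (⟷-≡ (cong₂ Tup (pushes-+ v ρ z) (pushes-bvars v ρ)))

  eval-TupSet : ∀ {b} k a {ρ τ} → ⟦ TupSet {b} k a ⟧ ρ τ ⟷ IsTupSet k (ρ a)
  eval-TupSet {b} k a = ⟷-Π λ z → ⟷-→ ⟷-refl (eval-IsTupleN {b} k 0)

  eval-subsets : ∀ {b n} (xs : Vec ℕ (suc n)) y {ρ τ} → ⟦ subsets {b} xs y ⟧ ρ τ ⟷ Vec.map ρ xs ⊑ ρ y
  eval-subsets (x ∷ []) y = (λ p → p ∷ []) , (λ { (p ∷ []) → p })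
  eval-subsets (x ∷ x′ ∷ xs) y =
    (λ p → ⊑-stable λ k → p λ q qs → k (q ∷ proj₁ (eval-subsets (x′ ∷ xs) y) qs)) ,
    (λ { (q ∷ qs) → both q (proj₂ (eval-subsets (x′ ∷ xs) y) qs) })

  eval-Corr : ∀ k F a {ρ τ} →
    ⟦ Corr k F a ⟧ ρ τ ⟷ (∀ v → Iff (App k (τ k F) v) (TupIn v (ρ a)))
  eval-Corr k F a {ρ} {τ} = ⟷-trans
    (eval-allN (suc k) (iff (app k F (bvars k)) (TupMem (bvars k) (a + suc k))))
    ((λ p v → proj₁ (at v) (p v)) , (λ p v → proj₂ (at v) (p v)))
    where
    at : ∀ v → ⟦ iff (app k F (bvars k)) (TupMem (bvars k) (a + suc k)) ⟧ (pushes v ρ) τ ⟷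
               Iff (App k (τ k F) v) (TupIn v (ρ a))
    at v = Iff-cong (⟷-≡ (cong (App k (τ k F)) (pushes-bvars v ρ)))
      (⟷-trans (eval-TupMem (bvars k) (a + suc k)) (⟷-≡ (cong₂ TupIn (pushes-bvars v ρ) (pushes-+ v ρ a))))

  eval-Sq : ∀ k F s {ρ τ} → ⟦ Sq k F s ⟧ ρ τ ⟷ (∀ v → App k (τ k F) v → v ⊑ ρ s)
  eval-Sq k F s {ρ} {τ} = ⟷-trans
    (eval-allN (suc k) (imp (app k F (bvars k)) (subsets (bvars k) (s + suc k))))
    ((λ p v → proj₁ (at v) (p v)) , (λ p v → proj₂ (at v) (p v)))
    where
    at : ∀ v → ⟦ imp (app k F (bvars k)) (subsets (bvars k) (s + suc k)) ⟧ (pushes v ρ) τ ⟷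
               (App k (τ k F) v → v ⊑ ρ s)
    at v = ⟷-→ (⟷-≡ (cong (App k (τ k F)) (pushes-bvars v ρ)))
      (⟷-trans (eval-subsets (bvars k) (s + suc k)) (⟷-≡ (cong₂ _⊑_ (pushes-bvars v ρ) (pushes-+ v ρ s))))

  Comprehends : ∀ k (φ : Formula true) → Env → Env2 → D → E → Set₁
  Comprehends k φ ρ τ s Y = And (∀ v → App k Y v → v ⊑ s)
    (∀ v → v ⊑ s → Iff (App k Y v) (⟦ φ ⟧ (pushes v (s ▸ ρ)) τ))

  -- `wk2` hides `Y` from `φ`, which is thus evaluated at `τ`; the level `s` stays visible to `φ`,
  -- just beyond the bound vector.
  eval-CompB : ∀ k φ {ρ τ} → ⟦ CompB k φ ⟧ ρ τ ⟷
    (∀ s → IsLev s → (∀ Y → Ok k Y → Comprehends k φ ρ τ s Y → R) → R)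
  eval-CompB k φ {ρ} {τ} = ⟷-Π λ s → ⟷-→ ⟷-refl (⟷-→ (⟷-Π λ Y → ⟷-→ ⟷-refl (⟷-→
    (And-cong
      (⟷-trans (eval-Sq k 0 0) (⟷-≡ (cong (λ F → ∀ v → App k F v → v ⊑ s) (push2-zero k Y τ))))
      (⟷-trans (eval-allN (suc k) matrix)
        ((λ p v → proj₁ (at s Y v) (p v)) , (λ p v → proj₂ (at s Y v) (p v)))))
    ⟷-refl)) ⟷-refl)
    where
    matrix : Formula true
    matrix = imp (subsets (bvars k) (suc k)) (iff (app k 0 (bvars k)) (wk2 k φ))
    at : ∀ s Y v → ⟦ matrix ⟧ (pushes v (s ▸ ρ)) (push2 k Y τ) ⟷
                   (v ⊑ s → Iff (App k Y v) (⟦ φ ⟧ (pushes v (s ▸ ρ)) τ))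
    at s Y v = ⟷-→
      (⟷-trans (eval-subsets (bvars k) (suc k))
        (⟷-≡ (cong₂ _⊑_ (pushes-bvars v (s ▸ ρ)) (pushes-+ v (s ▸ ρ) 0))))
      (Iff-cong (⟷-≡ (cong₂ (App k) (push2-zero k Y τ) (pushes-bvars v (s ▸ ρ))))
        (eval-ren φ (λ _ → refl) (push2-shift2 k Y τ)))

  IsPairOf-resp : ∀ {z z′ a a′ c c′} (ρ : Env) (τ : Env2) → z ≐ z′ → a ≐ a′ → c ≐ c′ →
                  IsPairOf z a c → IsPairOf z′ a′ c′
  IsPairOf-resp ρ τ p q r = proj₁ (eval-resp (IsPair {true} 0 1 2) {_ ▸ _ ▸ _ ▸ ρ} {_ ▸ _ ▸ _ ▸ ρ} {τ}
    λ { 0 → p ; 1 → q ; 2 → r ; (suc (suc (suc x))) → ≐-refl })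

  Tup-resp : ∀ {k z z′} {xs ys : Vec D (suc k)} (ρ : Env) (τ : Env2) → z ≐ z′ → Pointwise _≐_ xs ys →
             Tup z xs → Tup z′ ys
  Tup-resp ρ τ p (q ∷ []) t = ≐-trans (≐-sym p) (≐-trans t q)
  Tup-resp ρ τ p (q ∷ q′ ∷ qs) t k = t λ w r → r λ t′ pr →
    k w (both (Tup-resp ρ τ ≐-refl (q′ ∷ qs) t′) (IsPairOf-resp ρ τ p q ≐-refl pr))

  pushes-resp : ∀ {n} {v v′ : Vec D n} {ρ ρ′ : Env} → Pointwise _≐_ v v′ → (∀ x → ρ x ≐ ρ′ x) →
                ∀ x → pushes v ρ x ≐ pushes v′ ρ′ x
  pushes-resp [] h x = h x
  pushes-resp (p ∷ ps) h x = pushes-resp ps (λ { zero → p ; (suc x) → h x }) x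

-- Injectivity and existence of tuples

module TupleTheory (A : FO) (B : SO A) (L : Theory.LevelTheory A B) where
  open Eval A B
  open Sets A
  open Tuples A
  open Theory.LevelTheory L
  open Classical classical
  open Soundness A B classical
  open TupleEval A B classical
  open Levels A B L

  sing-member : ∀ {w a x} → IsSing w a → x ∈ w → x ≐ a
  sing-member sw = fwd ≐-stable (sw _)

  sing-has : ∀ {w a} → IsSing w a → a ∈ w
  sing-has sw = bwd ∈-stable (sw _) ≐-refl

  doub-left : ∀ {w a c} → IsDoub w a c → a ∈ w
  doub-left dw = bwd ∈-stable (dw _) λ n → ≐-stable λ _ → n ≐-refl

  doub-right : ∀ {w a c} → IsDoub w a c → c ∈ w
  doub-right dw = bwd ∈-stable (dw _) λ _ → ≐-refl

  doub-member : ∀ {w a c x} → IsDoub w a c → x ∈ w → (x ≐ a → R) → (x ≐ c → R) → R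
  doub-member dw x∈w n m = dw _ λ f _ → m (f x∈w n)

  pair-has-sing : ∀ {z a c w} → IsPairOf z a c → IsSing w a → w ∈ z
  pair-has-sing pz sw = ∈-stable λ k → pz _ λ _ g → k (g λ n x j → n sw)

  pair-has-doub : ∀ {z a c w} → IsPairOf z a c → IsDoub w a c → w ∈ z
  pair-has-doub pz dw = ∈-stable λ k → pz _ λ _ g → k (g λ _ → dw)

  pair-member : ∀ {z a c w} → IsPairOf z a c → w ∈ z → (IsSing w a → R) → (IsDoub w a c → R) → R
  pair-member pz w∈z n m = pz _ λ f _ → m (f w∈z n)

  pair-left : ∀ {z a c a′ c′} → IsPairOf z a c → IsPairOf z a′ c′ → a ≐ a′
  pair-left {a = a} p p′ = ≐-stable λ k → singleton a λ w sw →
    pair-member p′ (pair-has-sing p sw)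
      (λ sw′ → k (sing-member sw′ (sing-has sw)))
      (λ dw′ → k (≐-sym (sing-member sw (doub-left dw′))))

  pair-right : ∀ {z a c a′ c′} → IsPairOf z a c → IsPairOf z a′ c′ → c ≐ c′
  pair-right {z} {a} {c} {a′} {c′} p p′ = ≐-stable λ k →
    let -- if c = a then z = {{a}}, so c′ = a as well
        degenerate : c ≐ a → R
        degenerate c≐a = doubleton a′ c′ λ w dw → pair-member p (pair-has-doub p′ dw)
          (λ sw → k (≐-trans c≐a (≐-sym (sing-member sw (doub-right dw)))))
          (λ dw′ → doub-member dw′ (doub-right dw)
            (λ c′≐a → k (≐-trans c≐a (≐-sym c′≐a))) (λ c′≐c → k (≐-sym c′≐c)))
        a′≐a = ≐-sym (pair-left p p′)
    in doubleton a c λ w dw → pair-member p′ (pair-has-doub p dw)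
      (λ sw → degenerate (≐-trans (sing-member sw (doub-right dw)) a′≐a))
      (λ dw′ → doub-member dw′ (doub-right dw) (λ c≐a′ → degenerate (≐-trans c≐a′ a′≐a)) k)

  Tup-injective : ∀ {k z} (xs ys : Vec D (suc k)) → Tup z xs → Tup z ys → (Pointwise _≐_ xs ys → R) → R
  Tup-injective (x ∷ []) (y ∷ []) t t′ n = n (≐-trans (≐-sym t) t′ ∷ [])
  Tup-injective (x ∷ x′ ∷ xs) (y ∷ y′ ∷ ys) t t′ n = t λ w q → q λ tw p → t′ λ w′ q → q λ tw′ p′ →
    Tup-injective (x′ ∷ xs) (y′ ∷ ys) tw (Tup-resp {xs = y′ ∷ ys} ρ₀ τ₀ (≐-sym (pair-right p p′)) (PW.refl ≐-refl) tw′) λ qs →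
    n (pair-left p p′ ∷ qs)

  -- The doubleton of `x` and `w` is a member of the pair, so transitivity of `s` leads from `z` to
  -- it and on to `x` and `w`.
  Tup-members : ∀ {k z s} (xs : Vec D (suc k)) → Transitive s → Tup z xs → z ∈ s → VAll.All (_∈ s) xs
  Tup-members (x ∷ []) tr t z∈s = ∈-resp t ≐-refl z∈s ∷ []
  Tup-members {z = z} {s} (x ∷ x′ ∷ xs) tr t z∈s = All-stable _ ∈-stable λ k → t λ w q → q λ tw p →
    doubleton x w λ u du →
    let u∈s = tr z z∈s u (pair-has-doub p du) in
    k (tr u u∈s x (doub-left du) ∷ Tup-members (x′ ∷ xs) tr tw (tr u u∈s w (doub-right du)))

  Tup-⊑ : ∀ {k z s} (xs : Vec D (suc k)) → IsLev s → Tup z xs → z ∈ s → xs ⊑ s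
  Tup-⊑ xs ls t z∈s = VAll.map (λ {x} → lev-transitive ls x) (Tup-members xs (lev-transitive ls) t z∈s)

  -- A pair costs two levels: the singleton and the doubleton are subsets of `t`, hence members of
  -- `t₁`, and the pair is a subset of `t₁`, hence a member of `t₂`.
  pair-exists : ∀ {a c t t₁ t₂} → IsLev t → IsLev t₁ → IsLev t₂ → t ∈ t₁ → t₁ ∈ t₂ → a ∈ t → c ∈ t →
                Ex λ z → And (IsPairOf z a c) (z ∈ t₂)
  pair-exists {a} {c} {t} {t₁} {t₂} lt lt₁ lt₂ t∈t₁ t₁∈t₂ a∈t c∈t k =
    separate (or (Sing 0 1) (Doub 0 1 2)) (a ▸ c ▸ ρ₀) t₁ λ z spec →
    let inside : ∀ {w} → Or (IsSing w a) (IsDoub w a c) → w ∈ t₁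
        inside p = lev-potent lt₁ t∈t₁ λ x x∈w → ∈-stable λ j →
          doub-member (p λ sw → j (∈-resp (≐-sym (sing-member sw x∈w)) ≐-refl a∈t)) x∈w
            (λ x≐a → j (∈-resp (≐-sym x≐a) ≐-refl a∈t)) (λ x≐c → j (∈-resp (≐-sym x≐c) ≐-refl c∈t))
    in k z (both
      (λ w → both
        (λ w∈z n x j → spec w λ f _ → f w∈z λ _ p → p n x j)
        (λ p → ∈-stable λ j → spec w λ _ g → j (g (both (inside p) p))))
      (lev-potent lt₂ t₁∈t₂ λ w w∈z → ∈-stable λ j → spec w λ f _ → f w∈z λ w∈t₁ _ → j w∈t₁))

  -- One level must hold all the tuples at once for Separation to act on it. Endless is used once
  -- for the components and twice for every pair.
  tuples-exist : ∀ k {s} → IsLev s →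
    Ex λ t → And (IsLev t) (And (s ∈ t) ((v : Vec D (suc k)) → v ⊑ s → TupIn v t))
  tuples-exist zero {s} ls n = endlessness s ls λ t q → q λ lt s∈t →
    n t (both lt (both s∈t λ { (x ∷ []) (x⊆s ∷ []) → wit x (both ≐-refl (lev-potent lt s∈t x⊆s)) }))
  tuples-exist (suc k) {s} ls n = tuples-exist k ls λ t q → q λ lt q → q λ s∈t exist →
    endlessness t lt λ t₁ q → q λ lt₁ t∈t₁ → endlessness t₁ lt₁ λ t₂ q → q λ lt₂ t₁∈t₂ →
    n t₂ (both lt₂ (both (lev-transitive lt₂ t₁ t₁∈t₂ s (lev-transitive lt₁ t t∈t₁ s s∈t))
      λ { (x ∷ y ∷ ys) (x⊆s ∷ ps) j → exist (y ∷ ys) ps λ w q → q λ tw w∈t →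
            pair-exists lt lt₁ lt₂ t∈t₁ t₁∈t₂ (lev-potent lt s∈t x⊆s) w∈t λ z q → q λ pz z∈t₂ →
            j z (both (wit w (both tw pz)) z∈t₂) }))

  -- Boundedness puts all relevant tuples into one level `t`, from which Separation selects. By
  -- injectivity a selected tuple codes, up to `≐`, only the vector for which it was selected.
  tuple-set : ∀ k (φ : Formula true) {ρ τ} → OkEnv τ → ∀ {s} → IsLev s →
    (∀ v → ⟦ φ ⟧ (pushes v ρ) τ → v ⊑ s) →
    Ex λ a → And (IsTupSet k a) (∀ v → ⟦ φ ⟧ (pushes v ρ) τ ⟷ TupIn v a)
  tuple-set k φ {ρ} {τ} ok {s} ls bounded n =
    tuples-exist k ls λ t q → q λ lt q → q λ _ exist →
    separation (exN (suc k) body) ρ τ ok t λ a spec →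
    let unfold : ∀ z → z ∈ a → ((v : Vec D (suc k)) → Tup z v → ⟦ φ ⟧ (pushes v ρ) τ → R) → R
        unfold z z∈a j = spec z λ f _ → f z∈a λ _ p → proj₁ (eval-exN (suc k) body) p λ v p →
          p λ tz p → j v (proj₁ (at-tup z v) tz) (proj₁ (at-φ z v) p)
    in n a (both
      (λ z z∈a j → unfold z z∈a λ v tz _ → j v tz)
      (λ v →
        (λ φv j → exist v (bounded v φv) λ z q → q λ tz z∈t → spec z λ _ g →
          j z (both tz (g (both z∈t (proj₂ (eval-exN (suc k) body)
            λ i → i v (both (proj₂ (at-tup z v) tz) (proj₂ (at-φ z v) φv))))))) ,
        (λ p → stable φ λ j → p λ z q → q λ tz z∈a → unfold z z∈a λ v′ tz′ φv′ →
          Tup-injective v′ v tz′ tz λ e → j (proj₁ (eval-resp φ (pushes-resp e (λ _ → ≐-refl))) φv′))))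
    where
    body : Formula true
    -- Indices 0 to `k` are the components and `k + 1` is the candidate tuple, which the renaming of
    -- `φ` skips.
    body = and (IsTup (suc k) (bvars k)) (ren (extN (suc k) suc) id2 φ)
    at-tup : ∀ z v → ⟦ IsTup {true} (suc k) (bvars k) ⟧ (pushes v (z ▸ ρ)) τ ⟷ Tup z v
    at-tup z v = ⟷-trans (eval-IsTup (suc k) (bvars k))
      (⟷-≡ (cong₂ Tup (pushes-+ v (z ▸ ρ) 0) (pushes-bvars v (z ▸ ρ))))
    at-φ : ∀ z (v : Vec D (suc k)) → ⟦ ren (extN (suc k) suc) id2 φ ⟧ (pushes v (z ▸ ρ)) τ ⟷ ⟦ φ ⟧ (pushes v ρ) τ
    at-φ z v = eval-ren φ (pushes-extN v λ _ → refl) (λ _ _ → refl)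

-- Sets of tuples as second-order entities

tupleSO : (A : FO) → SO A
tupleSO A = record { E = D ; Ok = IsTupSet ; App = λ k a xs → TupIn xs a }
  where
  open FO A
  open Tuples A

module Expansion (A : FO) (B : SO A) (cl : Eval.Classical A B) where
  module M = Eval A B
  module N = Eval A (tupleSO A)
  open Logic A
  open Tuples A
  open M.Classical cl
  open TupleEval A B cl

  tuple-classical : M.Env → M.Env2 → N.Classical
  tuple-classical ρ τ = record
    { ∈-stable = ∈-stable ; ≐-stable = ≐-stable ; App-stable = λ p k → p λ q → q k
    ; ≐-refl = ≐-refl ; ≐-sym = ≐-sym ; ≐-trans = ≐-trans ; ∈-resp = ∈-resp
    ; App-resp = λ q p k → p λ z r → r λ t z∈a → k z (both (Tup-resp ρ τ ≐-refl q t) z∈a) }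

  eval-tr : ∀ φ {ρ σ e e′ τ τ′} → (∀ x → e (ρ x) ≡ e′ x) → (∀ j i → e (σ j i) ≡ τ′ j i) →
            M.⟦ tr ρ σ φ ⟧ e τ ⟷ N.⟦ φ ⟧ e′ τ′
  eval-tr (mem x y) h h₂ = ⟷-≡ (cong₂ _∈_ (h x) (h y))
  eval-tr (eq x y) h h₂ = ⟷-≡ (cong₂ _≐_ (h x) (h y))
  eval-tr bot h h₂ = ⟷-refl
  eval-tr (imp φ ψ) h h₂ = ⟷-→ (eval-tr φ h h₂) (eval-tr ψ h h₂)
  eval-tr (all φ) h h₂ = ⟷-Π λ d → eval-tr φ (λ { zero → refl ; (suc x) → h x }) h₂
  eval-tr (app k i xs) {ρ} {σ} h h₂ = ⟷-trans (eval-TupMem (Vec.map ρ xs) (σ k i))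
    (⟷-≡ (cong₂ TupIn (trans (sym (map-∘ _ ρ xs)) (map-cong h xs)) (h₂ k i)))
  eval-tr (all2 k φ) {σ = σ} {e} {τ′ = τ′} h h₂ =
    -- The guard inserted by `tr` is `TupSet k 0`, which evaluates to the condition `Ok` of the
    -- expansion.
    ⟷-Π λ a → ⟷-→ (eval-TupSet {false} k 0) (eval-tr φ h (same a))
    where
    same : ∀ a j i → (a ▸ e) (extT k σ j i) ≡ push2 k a τ′ j i
    same a j i with j ≡ᵇ k
    same a j zero | true = refl
    same a j (suc i) | true = h₂ j i
    same a j i | false = h₂ j i

-- Models of LT1+

module FirstOrder (A : FO) (B : SO A) (cl : Eval.Classical A B)
                  (models : Eval.Models A B LT1+)
                  (ρ₀ : Eval.Env A B) (τ₀ : Eval.Env2 A B) (ok₀ : Eval.OkEnv A B τ₀) where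
  open Expansion A B cl public
  open Logic A
  open Sets A
  open Tuples A
  open M.Classical cl

  separation₁ : ∀ (φ : Formula false) ρ a →
    Ex λ c → ∀ x → Iff (x ∈ c) (And (x ∈ a) (M.⟦ φ ⟧ (x ▸ ρ) τ₀))
  separation₁ φ ρ a k = models (sep φ) ρ τ₀ ok₀ a λ c spec → k c λ x →
    proj₁ (Iff-cong ⟷-refl (And-cong ⟷-refl
      (M.eval-ren φ (λ { zero → refl ; (suc i) → refl }) (λ _ _ → refl)))) (spec x)

  -- Vacuously a set of tuples of every arity, hence an admissible default for second-order
  -- variables. It exists only up to double negation, so what follows takes it as a module
  -- parameter.
  empty-set : Ex λ e → ∀ x → x ∈ e → R
  empty-set k = separation₁ bot ρ₀ (ρ₀ 0) λ e spec → k e λ x x∈e → spec x λ f _ → f x∈e λ _ → id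

  -- Second-order values are elements of D here, so parameters of both kinds fit into one environment.
  merge : (ℕ → D) → (ℕ → ℕ → D) → ℕ → D
  merge ρ τ n with unpair n
  ... | zero , i = ρ i
  ... | suc k , i = τ k i

  merge-ρ : ∀ ρ τ i → merge ρ τ (code 0 i) ≡ ρ i
  merge-ρ ρ τ i rewrite unpair-code 0 i = refl

  merge-τ : ∀ ρ τ k i → merge ρ τ (code (suc k) i) ≡ τ k i
  merge-τ ρ τ k i rewrite unpair-code (suc k) i = refl

  separation₂ : ∀ (φ : Formula true) ρ τ a →
    Ex λ c → ∀ x → Iff (x ∈ c) (And (x ∈ a) (N.⟦ φ ⟧ (x ▸ ρ) τ))
  separation₂ φ ρ τ a k =
    separation₁ (tr (ext (code 0)) (λ j i → suc (code (suc j) i)) φ) (merge ρ τ) a λ c spec → k c λ x →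
    proj₁ (Iff-cong ⟷-refl (And-cong ⟷-refl
      (eval-tr φ (λ { zero → refl ; (suc i) → merge-ρ ρ τ i }) (merge-τ ρ τ)))) (spec x)

  module _ (e : D) (empty : ∀ x → x ∈ e → R) where

    empty-ok : N.OkEnv (λ _ _ → e)
    empty-ok k i z z∈e _ = empty z z∈e

    expansion-theory : Theory.LevelTheory A (tupleSO A)
    expansion-theory = record
      { classical = tuple-classical ρ₀ τ₀
      ; ρ₀ = ρ₀ ; τ₀ = λ _ _ → e ; ok₀ = empty-ok
      ; extensionality = models extAx ρ₀ τ₀ ok₀
      ; separation = λ φ ρ τ _ → separation₂ φ ρ τ
      ; stratification = models strat ρ₀ τ₀ ok₀
      ; endlessness = models endless ρ₀ τ₀ ok₀ }

    open TupleTheory A (tupleSO A) expansion-theory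
    open TupleEval A (tupleSO A) (tuple-classical ρ₀ τ₀)

    expansion-models : N.Models LTb+
    expansion-models extAx ρ τ ok = models extAx ρ₀ τ₀ ok₀
    expansion-models sep ρ τ ok Y _ a = separation₂ (app 0 0 (0 ∷ [])) ρ (push2 0 Y τ) a
    expansion-models strat ρ τ ok = models strat ρ₀ τ₀ ok₀
    expansion-models endless ρ τ ok = models endless ρ₀ τ₀ ok₀
    -- As a set, `Y` lies below a level `s`; the components of its tuples are members, hence
    -- subsets, of `s`.
    expansion-models (stratb k) ρ τ ok Y _ n = models strat ρ₀ τ₀ ok₀ Y λ s q → q λ ls Y⊆s →
      n s (both ls (proj₂ (eval-Sq k 0 0) (subst (λ F → ∀ v → TupIn v F → v ⊑ s) (sym (push2-zero k Y τ))
        λ v p → ⊑-stable λ j → p λ z q → q λ tz z∈Y → j (Tup-⊑ v ls tz (Y⊆s z z∈Y)))))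
    expansion-models (compb k φ) ρ τ ok = proj₂ (eval-CompB k φ) λ s ls n →
      let at : ∀ v → N.⟦ subsets {true} (bvars k) (suc k) ⟧ (pushes v (s ▸ ρ)) τ ⟷ v ⊑ s
          at v = ⟷-trans (eval-subsets (bvars k) (suc k))
            (⟷-≡ (cong₂ _⊑_ (pushes-bvars v (s ▸ ρ)) (pushes-+ v (s ▸ ρ) 0)))
          bounded : ∀ v → N.⟦ and (subsets (bvars k) (suc k)) φ ⟧ (pushes v (s ▸ ρ)) τ → v ⊑ s
          bounded v p = ⊑-stable λ j → p λ q _ → j (proj₁ (at v) q)
      -- The added conjunct makes the relation bounded by `s`.
      in tuple-set k (and (subsets (bvars k) (suc k)) φ) {s ▸ ρ} {τ} ok ls bounded λ a q → q λ ta spec →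
         n a ta (both
           (λ v p → bounded v (proj₂ (spec v) p))
           (λ v v⊑s → both
             (λ p → N-stable φ λ j → proj₂ (spec v) p λ _ q → j q)
             (λ q → proj₁ (spec v) (both (proj₂ (at v) v⊑s) q))))
      where
      open Soundness A (tupleSO A) (tuple-classical ρ₀ τ₀) renaming (stable to N-stable)

-- Models of LTb+

module SecondOrder (A : FO) (B : SO A) (cl : Eval.Classical A B)
                   (models : Eval.Models A B LTb+)
                   (ρ₀ : Eval.Env A B) (τ₀ : Eval.Env2 A B) (ok₀ : Eval.OkEnv A B τ₀) where
  open Expansion A B cl public
  open Eval A B
  open Sets A
  open Tuples A
  open Classical cl
  open Soundness A B cl
  open TupleEval A B cl

  comprehension : ∀ k (φ : Formula true) ρ τ → OkEnv τ → ∀ s → IsLev s →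
    (∀ Y → Ok k Y → Comprehends k φ ρ τ s Y → R) → R
  comprehension k φ ρ τ ok = proj₁ (eval-CompB k φ) (models (compb k φ) ρ τ ok)

  separation₂ : ∀ (φ : Formula true) ρ τ → OkEnv τ → ∀ a →
    Ex λ c → ∀ x → Iff (x ∈ c) (And (x ∈ a) (⟦ φ ⟧ (x ▸ ρ) τ))
  separation₂ φ ρ τ ok a n =
    models strat ρ₀ τ₀ ok₀ a λ s q → q λ ls a⊆s →
    -- Comp_b places `s` between the bound variable and the parameters; the renaming skips it.
    comprehension 0 (ren (ext suc) id2 φ) ρ τ ok s ls λ F okF q → q λ _ F-spec →
    models sep ρ τ ok F okF a λ c spec →
    let at : ∀ {x} → x ∈ a → Iff (App 0 F (x ∷ [])) (⟦ φ ⟧ (x ▸ ρ) τ)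
        at {x} x∈a = proj₁ (Iff-cong ⟷-refl
          (eval-ren φ (λ { zero → refl ; (suc i) → refl }) (λ _ _ → refl)))
          (F-spec (x ∷ []) (level-transitive ∈-stable ls x (a⊆s x x∈a) ∷ []))
    in n c λ x → both
      (λ x∈c j → spec x λ f _ → f x∈c λ x∈a Fx → at x∈a λ g _ → j x∈a (g Fx))
      (λ p → ∈-stable λ j → p λ x∈a φx → at x∈a λ _ g → spec x λ _ f → j (f (both x∈a (g φx))))

  theory : Theory.LevelTheory A B
  theory = record
    { classical = cl ; ρ₀ = ρ₀ ; τ₀ = τ₀ ; ok₀ = ok₀
    ; extensionality = models extAx ρ₀ τ₀ ok₀
    ; separation = separation₂
    ; stratification = models strat ρ₀ τ₀ ok₀
    ; endlessness = models endless ρ₀ τ₀ ok₀ }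

  reduct-models : Models LT1+
  reduct-models extAx ρ τ ok = models extAx ρ τ ok
  reduct-models (sep φ) ρ τ ok a n = separation₂ (emb φ) ρ τ ok a λ c spec → n c λ x →
    proj₁ (Iff-cong ⟷-refl (And-cong ⟷-refl (⟷-trans (eval-emb B B φ)
      (⟷-sym (eval-ren φ (λ { zero → refl ; (suc i) → refl }) (λ _ _ → refl)))))) (spec x)
  reduct-models strat ρ τ ok = models strat ρ τ ok
  reduct-models endless ρ τ ok = models endless ρ τ ok

  open TupleTheory A B theory

  Represents : ∀ k → E → D → Set₁
  Represents k Y a = ∀ v → App k Y v ⟷ TupIn v a

  represented : ∀ k Y → Ok k Y → Ex λ a → And (IsTupSet k a) (Represents k Y a)
  represented k Y okY n = models (stratb k) ρ₀ τ₀ ok₀ Y okY λ s q → q λ ls sq →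
    tuple-set k (app k 0 (bvars k)) {ρ₀} {push2 k Y τ₀} (Ok-push2 k okY ok₀) ls
      (λ v p → proj₁ (eval-Sq k 0 0) sq v (subst (App k _) (pushes-bvars v ρ₀) p)) λ a q → q λ ta spec →
    n a (both ta λ v → ⟷-trans
      (⟷-≡ (sym (cong₂ (App k) (push2-zero k Y τ₀) (pushes-bvars v ρ₀)))) (spec v))

  represents : ∀ k a → (∀ Y → Ok k Y → Represents k Y a → R) → R
  represents k a n = models strat ρ₀ τ₀ ok₀ a λ s q → q λ ls a⊆s →
    -- Index `k + 2` is `a`, beyond the `k + 1` components and `s`.
    comprehension k (TupMem (bvars k) (suc (suc k))) (a ▸ ρ₀) τ₀ ok₀ s ls λ Y okY q → q λ bounded spec →
    let at : ∀ v → ⟦ TupMem {true} (bvars k) (suc (suc k)) ⟧ (pushes v (s ▸ a ▸ ρ₀)) τ₀ ⟷ TupIn v a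
        at v = ⟷-trans (eval-TupMem (bvars k) (suc (suc k)))
          (⟷-≡ (cong₂ TupIn (pushes-bvars v (s ▸ a ▸ ρ₀)) (pushes-+ v (s ▸ a ▸ ρ₀) 1)))
        below : ∀ v → TupIn v a → v ⊑ s
        below v p = ⊑-stable λ j → p λ z q → q λ tz z∈a → j (Tup-⊑ v ls tz (a⊆s z z∈a))
    in n Y okY λ v →
      (λ p j → spec v (bounded v p) λ f _ → proj₁ (at v) (f p) j) ,
      (λ p → App-stable λ j → spec v (below v p) λ _ g → j (g (proj₂ (at v) p)))

  iso₁ : ∀ k → ⟦ Iso1 k ⟧ ρ₀ τ₀
  iso₁ k Y okY n = represented k Y okY λ a q → q λ ta r →
    n a (both (proj₂ (eval-TupSet {true} k 0) ta)
      (proj₂ (eval-Corr k 0 0) λ v →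
        subst (λ F → Iff (App k F v) (TupIn v a)) (sym (push2-zero k Y τ₀)) (toIff (r v))))

  iso₂ : ∀ k → ⟦ Iso2 k ⟧ ρ₀ τ₀
  iso₂ k a _ n = represents k a λ Y okY r →
    n Y okY (proj₂ (eval-Corr k 0 0) λ v →
      subst (λ F → Iff (App k F v) (TupIn v a)) (sym (push2-zero k Y τ₀)) (toIff (r v)))

  -- At a second-order quantifier, `represents` or `represented` supplies the counterpart on the
  -- other side, though only up to double negation; stability of the matrix removes it.
  eval-iso : ∀ (φ : Formula true) {m c ρ τ τ′} → Scoped m c φ →
    (∀ j i → i < c j → Represents j (τ j i) (τ′ j i)) → ⟦ φ ⟧ ρ τ ⟷ N.⟦ φ ⟧ ρ τ′
  eval-iso (mem x y) s h = ⟷-refl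
  eval-iso (eq x y) s h = ⟷-refl
  eval-iso bot s h = ⟷-refl
  eval-iso (imp φ ψ) (s , s′) h = ⟷-→ (eval-iso φ s h) (eval-iso ψ s′ h)
  eval-iso (all φ) s h = ⟷-Π λ d → eval-iso φ s h
  eval-iso (app k i xs) (p , _) h = h k i p _
  eval-iso (all2 k φ) {c = c} {τ = τ} {τ′} s h =
    (λ f a _ → N-stable φ λ j → represents k a λ Y okY r →
      j (proj₁ (eval-iso φ s (extend Y a r)) (f Y okY))) ,
    (λ f Y okY → stable φ λ j → represented k Y okY λ a q → q λ ta r →
      j (proj₂ (eval-iso φ s (extend Y a r)) (f a ta)))
    where
    open Soundness A (tupleSO A) (tuple-classical ρ₀ τ₀) using () renaming (stable to N-stable)
    extend : ∀ Y a → Represents k Y a → ∀ j i → i < bump k c j →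
             Represents j (push2 k Y τ j i) (push2 k a τ′ j i)
    extend Y a r j i p with j ≡ᵇ k in e
    extend Y a r j zero p | true = subst (λ l → Represents l Y a) (sym (≡ᵇ-true e)) r
    extend Y a r j (suc i) (s≤s p) | true = h j i p
    extend Y a r j i p | false = h j i p

-- The two equivalences and the isomorphism

theorem23 : ((φ : Formula false) → Sentence φ →
    (LT1+ ⊢ φ → LTb+ ⊢ emb φ) × (LTb+ ⊢ emb φ → LT1+ ⊢ φ))
    × ((φ : Formula true) → Sentence φ →
    (LTb+ ⊢ φ → LT1+ ⊢ φ ↓) × (LT1+ ⊢ φ ↓ → LTb+ ⊢ φ))
    × ((k : ℕ) → (LTb+ ⊢ Iso1 k) × (LTb+ ⊢ Iso2 k))
theorem23 =
  (λ φ _ →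
    (λ d → complete LTb+-ren (emb φ) λ A B cl M ρ τ ok →
      let open SecondOrder A B cl M ρ τ ok in
      proj₂ (eval-emb B B φ) (Soundness.sound A B cl reduct-models d ρ τ ok)) ,
    (λ d → complete LT1+-ren φ λ A B cl M ρ τ ok →
      let open FirstOrder A B cl M ρ τ ok in
      Soundness.stable A B cl φ λ k → empty-set λ e empty →
      k (proj₁ (eval-emb (tupleSO A) B φ)
        (Soundness.sound A (tupleSO A) (tuple-classical ρ τ) (expansion-models e empty) d ρ _ (empty-ok e empty))))) ,
  (λ φ closed →
    (λ d → complete LT1+-ren (φ ↓) λ A B cl M ρ τ ok →
      let open FirstOrder A B cl M ρ τ ok in
      Soundness.stable A B cl (φ ↓) λ k → empty-set λ e empty →
      -- `_↓` sends second-order index `i` of every arity to first-order index `i`, so `eval-tr`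
      -- reads second-order variables as values `ρ i`, which need not be sets of tuples. As `φ` is
      -- closed, `eval-scoped` passes to the empty-set environment, where soundness applies.
      k (proj₂ (eval-tr φ (λ _ → refl) (λ _ _ → refl))
        (proj₁ (N.eval-scoped φ closed (λ _ _ → refl) (λ _ _ ()))
          (Soundness.sound A (tupleSO A) (tuple-classical ρ τ) (expansion-models e empty) d ρ _ (empty-ok e empty))))) ,
    (λ d → complete LTb+-ren φ λ A B cl M ρ τ ok →
      let open SecondOrder A B cl M ρ τ ok in
      proj₂ (eval-iso φ closed (λ _ _ ()))
        (proj₁ (eval-tr φ (λ _ → refl) (λ _ _ → refl))
          (Soundness.sound A B cl reduct-models d ρ τ ok)))) ,
  (λ k →
    complete LTb+-ren (Iso1 k) (λ A B cl M ρ τ ok → SecondOrder.iso₁ A B cl M ρ τ ok k) ,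
    complete LTb+-ren (Iso2 k) (λ A B cl M ρ τ ok → SecondOrder.iso₂ A B cl M ρ τ ok k))
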